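{- Let $L/K$ be a finite extension with maximal separable subextension $L_S/K$ and maximal purely inseparable subextension $L_I/K$, and let $A=\mathrm{Aut}(L/K)$ with fixed field $L^A$. The following are equivalent: (a) $L/K$ is normal; (b) $t_K(L)=[L:L_I]$; (c) $u_K(L)=1$ and $L=L_SL_I$; (d) $L^A=L_I$; (e) $L/L_I$ is Galois.
   Context: $K$ is any field (not necessarily perfect) with a fixed algebraic closure $\bar K$; all extensions are finite and contained in $\bar K$. With $F/K$ the largest Galois subextension of $L/K$ (so $F\subset L_S$), the ascending index is $t_K(L)=[F:K]$ and $u_K(L)=[L_S:F]$. -}

module Defs where

open import Level using (Level; _⊔_; suc)
open import Algebra.Bundles using (CommutativeRing; RawRing)
open import Algebra.Apartness.Bundles using (HeytingField)
open import Algebra.Morphism.Structures using (module RingMorphisms)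
import Algebra.Properties.CommutativeMonoid.Sum as Sum
open import Axiom.ExcludedMiddle using (ExcludedMiddle)
open import Data.Fin.Base using (Fin)
open import Data.List.Base using (List; []; _∷_; map; foldr)
open import Data.List.Relation.Unary.All using (All)
import Data.List.Relation.Unary.Unique.Setoid as UniqueSetoid
open import Data.Nat.Base as ℕ using (ℕ)
open import Data.Product.Base using (Σ; ∃; _×_; _,_; proj₁; proj₂; Σ-syntax; ∃-syntax)
open import Relation.Binary.Definitions using (_Respects_)
open import Relation.Nullary.Decidable.Core using (yes; no)
open import Relation.Unary using (Pred; _∈_; _⊆_)

-- All fields under consideration are subfields of one ambient field Ω.
-- Under excluded middle, apartness in a Heyting field is the negation of
-- equality, so Heyting fields are exactly the classical fields.
module FieldExtensions
  (em : ∀ {a : Level} → ExcludedMiddle a)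
  {c ℓ₁ ℓ₂ : Level} (Ω : HeytingField c ℓ₁ ℓ₂)
  where

  open HeytingField Ω using (heytingCommutativeRing)
  open import Algebra.Apartness.Bundles using (module HeytingCommutativeRing)
  open HeytingCommutativeRing heytingCommutativeRing using (commutativeRing)
  open CommutativeRing commutativeRing
    using (Carrier; _≈_; _+_; _*_; -_; 0#; 1#; setoid; +-commutativeMonoid)
  open Sum +-commutativeMonoid using (sum)
  open UniqueSetoid setoid using (Unique)

  record Subfield : Set (suc (c ⊔ ℓ₁)) where
    field
      ∣_∣       : Pred Carrier (c ⊔ ℓ₁)
      resp      : ∣_∣ Respects _≈_
      0∈        : 0# ∈ ∣_∣
      1∈        : 1# ∈ ∣_∣
      +-closed  : ∀ {x y} → x ∈ ∣_∣ → y ∈ ∣_∣ → x + y ∈ ∣_∣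
      *-closed  : ∀ {x y} → x ∈ ∣_∣ → y ∈ ∣_∣ → x * y ∈ ∣_∣
      -‿closed  : ∀ {x} → x ∈ ∣_∣ → - x ∈ ∣_∣
      ⁻¹-closed : ∀ {x y} → x ∈ ∣_∣ → x * y ≈ 1# → y ∈ ∣_∣

  open Subfield public using (∣_∣)

  infix 4 _≤_
  _≤_ : Subfield → Subfield → Set (c ⊔ ℓ₁)
  E ≤ F = ∣ E ∣ ⊆ ∣ F ∣

  rawRing : Subfield → RawRing (c ⊔ ℓ₁) ℓ₁
  rawRing E = record
    { Carrier = ∃ ∣ E ∣
    ; _≈_     = λ x y → proj₁ x ≈ proj₁ y
    ; _+_     = λ x y → proj₁ x + proj₁ y , +-closed (proj₂ x) (proj₂ y)
    ; _*_     = λ x y → proj₁ x * proj₁ y , *-closed (proj₂ x) (proj₂ y)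
    ; -_      = λ x → - proj₁ x , -‿closed (proj₂ x)
    ; 0#      = 0# , 0∈
    ; 1#      = 1# , 1∈
    }
    where open Subfield E using (0∈; 1∈; +-closed; *-closed; -‿closed)

  compositum : Subfield → Subfield → Pred Carrier (suc (c ⊔ ℓ₁))
  compositum E F x = ∀ M → E ≤ M → F ≤ M → x ∈ ∣ M ∣

  -- Coefficient lists, constant term first; trailing zeros are allowed,
  -- so equality of polynomials is _≋_ below.
  Polynomial : Set c
  Polynomial = List Carrier

  coeff : Polynomial → ℕ → Carrier
  coeff []      _         = 0#
  coeff (a ∷ p) ℕ.zero    = a
  coeff (a ∷ p) (ℕ.suc i) = coeff p i

  infix 4 _≋_
  _≋_ : Polynomial → Polynomial → Set ℓ₁
  p ≋ q = ∀ i → coeff p i ≈ coeff q i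

  eval : Polynomial → Carrier → Carrier
  eval p x = foldr (λ a v → a + x * v) 0# p

  infixl 6 _⊞_
  _⊞_ : Polynomial → Polynomial → Polynomial
  []      ⊞ q       = q
  (a ∷ p) ⊞ []      = a ∷ p
  (a ∷ p) ⊞ (b ∷ q) = a + b ∷ p ⊞ q

  infixl 7 _⊠_
  _⊠_ : Polynomial → Polynomial → Polynomial
  []      ⊠ q = []
  (a ∷ p) ⊠ q = map (a *_) q ⊞ (0# ∷ p ⊠ q)

  -- ∏ (X - r) over the entries r of the list
  fromRoots : List Carrier → Polynomial
  fromRoots = foldr (λ r p → (- r ∷ 1# ∷ []) ⊠ p) (1# ∷ [])

  MonicOfDegree : ℕ → Polynomial → Set ℓ₁
  MonicOfDegree n p = coeff p n ≈ 1# × (∀ i → n ℕ.< i → coeff p i ≈ 0#)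

  IsMonicAnnihilator : Subfield → Carrier → ℕ → Polynomial → Set (c ⊔ ℓ₁)
  IsMonicAnnihilator K x n p = All ∣ K ∣ p × MonicOfDegree n p × eval p x ≈ 0#

  IsMinimalPolynomial : Subfield → Carrier → Polynomial → Set (c ⊔ ℓ₁)
  IsMinimalPolynomial K x p =
    ∃[ n ] IsMonicAnnihilator K x n p
         × (∀ m q → IsMonicAnnihilator K x m q → n ℕ.≤ m)

  SplitsIn : Subfield → Polynomial → Set (c ⊔ ℓ₁)
  SplitsIn L p = ∃[ rs ] All ∣ L ∣ rs × p ≋ fromRoots rs

  -- The roots lie in Ω, which will be an algebraic closure of the base field.
  SplitsWithDistinctRoots : Polynomial → Set (c ⊔ ℓ₁)
  SplitsWithDistinctRoots p = ∃[ rs ] Unique rs × p ≋ fromRoots rs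

  AlgebraicOver : Subfield → Carrier → Set (c ⊔ ℓ₁)
  AlgebraicOver K x = ∃[ n ] ∃[ p ] IsMonicAnnihilator K x n p

  AlgebraicallyClosed : Set (c ⊔ ℓ₁)
  AlgebraicallyClosed =
    ∀ n p → MonicOfDegree (ℕ.suc n) p → ∃[ x ] eval p x ≈ 0#

  IsAlgebraicClosureOf : Subfield → Set (c ⊔ ℓ₁)
  IsAlgebraicClosureOf K = AlgebraicallyClosed × (∀ x → AlgebraicOver K x)

  combination : ∀ {n} → (Fin n → Carrier) → (Fin n → Carrier) → Carrier
  combination a b = sum (λ i → a i * b i)

  record IsBasis (L K : Subfield) {n} (b : Fin n → Carrier) : Set (c ⊔ ℓ₁) where
    field
      b∈L         : ∀ i → b i ∈ ∣ L ∣
      spanning    : ∀ {x} → x ∈ ∣ L ∣ →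
                    Σ[ a ∈ (Fin n → Carrier) ]
                      (∀ i → a i ∈ ∣ K ∣) × x ≈ combination a b
      independent : ∀ a → (∀ i → a i ∈ ∣ K ∣) → combination a b ≈ 0# →
                    ∀ i → a i ≈ 0#

  HasFiniteBasis : Subfield → Subfield → Set (c ⊔ ℓ₁)
  HasFiniteBasis L K = Σ[ n ∈ ℕ ] Σ[ b ∈ (Fin n → Carrier) ] IsBasis L K b

  IsFiniteExtension : Subfield → Subfield → Set (c ⊔ ℓ₁)
  IsFiniteExtension L K = K ≤ L × HasFiniteBasis L K

  -- The dimension of L over K, with the junk value 0 when there is no
  -- finite basis.
  [_∶_] : Subfield → Subfield → ℕ
  [ L ∶ K ] with em {P = HasFiniteBasis L K}
  ... | yes (n , _) = n
  ... | no  _       = 0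

  SeparableElement : Subfield → Carrier → Set (c ⊔ ℓ₁)
  SeparableElement K x =
    ∃[ p ] IsMinimalPolynomial K x p × SplitsWithDistinctRoots p

  IsSeparable : Subfield → Subfield → Set (c ⊔ ℓ₁)
  IsSeparable E K = ∀ {x} → x ∈ ∣ E ∣ → SeparableElement K x

  IsPurelyInseparable : Subfield → Subfield → Set (c ⊔ ℓ₁)
  IsPurelyInseparable E K =
    ∀ {x} → x ∈ ∣ E ∣ → AlgebraicOver K x × (SeparableElement K x → x ∈ ∣ K ∣)

  IsNormal : Subfield → Subfield → Set (c ⊔ ℓ₁)
  IsNormal E K =
    ∀ {x} → x ∈ ∣ E ∣ → ∃[ p ] IsMinimalPolynomial K x p × SplitsIn E p

  IsGalois : Subfield → Subfield → Set (c ⊔ ℓ₁)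
  IsGalois E K = IsNormal E K × IsSeparable E K

  record IsLargestSubextension
    (P : Subfield → Subfield → Set (c ⊔ ℓ₁)) (L K E : Subfield)
    : Set (suc (c ⊔ ℓ₁)) where
    field
      K≤E      : K ≤ E
      E≤L      : E ≤ L
      property : P E K
      largest  : ∀ E′ → K ≤ E′ → E′ ≤ L → P E′ K → E′ ≤ E

  record Aut (L K : Subfield) : Set (c ⊔ ℓ₁) where
    open RingMorphisms (rawRing L) (rawRing L) using (IsRingIsomorphism)
    field
      ⟦_⟧               : ∃ ∣ L ∣ → ∃ ∣ L ∣
      isRingIsomorphism : IsRingIsomorphism ⟦_⟧
      fixes             : ∀ x → proj₁ x ∈ ∣ K ∣ → proj₁ (⟦_⟧ x) ≈ proj₁ x

  fixedField : Subfield → Subfield → Pred Carrier (c ⊔ ℓ₁)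
  fixedField L K x =
    Σ[ x∈L ∈ x ∈ ∣ L ∣ ] ∀ (σ : Aut L K) → proj₁ (Aut.⟦ σ ⟧ (x , x∈L)) ≈ x

{-# OPTIONS --safe #-}

-- L/K is normal iff every K-embedding of L into K̄ maps L into itself, and Lᵢ
-- consists of the elements fixed by all these embeddings: an element with a
-- single conjugate is purely inseparable, and conversely Frobenius is
-- injective, while x ^ p has smaller degree than an inseparable x.  So normality
-- over Lᵢ gives normality over K, and Artin's orbit polynomials show that
-- L^A = Lᵢ makes L/Lᵢ Galois.  If L is normal then so is Lₛ, hence Lₛ = F, and an
-- embedding fixing Lₛ and Lᵢ fixes L by the same Frobenius descent, so
-- L = Lₛ Lᵢ; conversely the elements which an embedding sends into L form a
-- field containing F and Lᵢ.  Finally F and Lᵢ are linearly disjoint over K, so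
-- [F : K] = [F Lᵢ : Lᵢ], and this is [L : Lᵢ] iff L = F Lᵢ.  That K(x) is separable
-- for separable x is proved with derivations, as homomorphisms to dual numbers.
module Submission where

open import Defs
open import Level using (Level; _⊔_; Lift; lift)
open import Algebra.Bundles using (CommutativeRing; RawRing)
open import Algebra.Apartness.Bundles using (HeytingField; module HeytingCommutativeRing)
open import Algebra.Morphism.Structures using (module RingMorphisms)
import Algebra.Properties.AbelianGroup
import Algebra.Properties.CommutativeSemiring.Binomial
import Algebra.Properties.Ring
import Algebra.Properties.Semiring.Exp
import Algebra.Properties.Semiring.Mult
import Algebra.Properties.Semiring.Mult.TCOptimised
import Algebra.Properties.Semiring.Sum
import Algebra.Solver.Ring
open import Algebra.Solver.Ring.AlmostCommutativeRing using (fromCommutativeRing; _-Raw-AlmostCommutative⟶_)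
open import Axiom.ExcludedMiddle using (ExcludedMiddle)
open import Data.Empty using (⊥; ⊥-elim)
open import Data.Fin.Base using (Fin; zero; suc; toℕ; fromℕ; inject₁; punchIn; punchOut)
open import Data.Fin.Properties as Fin using (toℕ<n; toℕ-fromℕ; toℕ-inject₁; pigeonhole; punchIn-punchOut)
open import Data.List.Base as List using (List; []; _∷_; map; foldr; drop; length)
open import Data.List.Properties using (length-drop; length-map)
open import Data.List.Relation.Unary.All as All using (All; []; _∷_)
open import Data.List.Relation.Unary.All.Properties using (drop⁺; ¬Any⇒All¬; map⁺)
open import Data.List.Relation.Unary.AllPairs using ([]; _∷_)
open import Data.List.Relation.Unary.Any as Any using (Any; here; there)
open import Data.List.Relation.Unary.Any.Properties using (lookup-index)
import Data.List.Relation.Unary.Unique.Setoid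
open import Data.Maybe.Base using (Maybe; just; nothing)
open import Data.Nat.Base as ℕ using (ℕ; z≤n; s≤s; _!)
open import Data.Nat.Combinatorics using (_C_; nCn≡1; k![n∸k]!∣n!; nCk≡n!/k![n-k]!)
open import Data.Nat.DivMod using (_/_; _%_; m≡m%n+[m/n]*n; m%n<n; m/n*n≡m)
open import Data.Nat.Divisibility using (divides; m%n≡0⇒n∣m; ∣m+n∣m⇒∣n; ∣-refl; >⇒∤) renaming (_∣_ to _∣ₙ_)
open import Data.Nat.Induction using (<-rec)
open import Data.Nat.Properties as ℕₚ using (_!*_!≢0)
open import Data.Product.Base using (∃; _×_; _,_; proj₁; proj₂; Σ-syntax; ∃-syntax)
open import Data.Product.Properties using (≡-dec)
import Data.Product.Relation.Binary.Pointwise.NonDependent as Pointwise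
open import Data.Sum.Base using (_⊎_; inj₁; inj₂; [_,_]′)
open import Data.Unit.Base using (⊤)
import Data.Vec.Functional as Vector
open import Data.Vec.Functional.Properties using (insertAt-lookup; insertAt-punchIn)
open import Function.Base using (id; _∘_)
open import Function.Bundles using (_⇔_; mk⇔)
open import Relation.Binary.Definitions using (_Respects_)
open import Relation.Binary.PropositionalEquality as ≡ using (_≡_)
import Relation.Binary.Reasoning.Setoid
open import Relation.Nullary using (¬_; Dec; yes; no; contradiction)
open import Relation.Unary using (Pred; _∈_; _⊆_; _≐_)

-- Condition (a) is the hub: each other condition is compared with it. The work is done with
-- embeddings of L into the ambient field, because a non-normal L may have too few automorphisms to
-- detect anything. The subextensions are known only by maximality among intermediate fields, so an
-- element enters `Lₛ` or `Lᵢ` only as a member of a whole field of the right kind. This is why K(x)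
-- has to be shown separable and why the elements fixed by all embeddings are first assembled into a
-- field. Homomorphisms take values in an arbitrary commutative ring: with target Ω they are
-- embeddings, with target the dual numbers they encode derivations, and a single extension lemma
-- for simple extensions serves both. Purely inseparable means having no separable elements outside
-- K. Accordingly exponents of p are never accumulated: one p-th power at a time is handled by
-- induction on the degree of an annihilator. Since a degree has the default value 0, an equation
-- between degrees is turned into a statement about actual bases before it is used.

-- A coefficient (m , n) stands for the integer m - n.  The library solver
-- instantiated at the ring itself cannot cancel x - x, because equality of
-- its coefficients does not compute.
module IntegerRingSolver {r₁ r₂} (R : CommutativeRing r₁ r₂) where
  open CommutativeRing R
  open Algebra.Properties.Ring ring using (-‿distribˡ-*; -‿distribʳ-*)
  open Algebra.Properties.AbelianGroup +-abelianGroup using (⁻¹-∙-comm; ⁻¹-involutive; ε⁻¹≈ε)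
  open Algebra.Properties.Semiring.Mult semiring using (×-homo-+; ×1-homo-*) renaming (_×_ to _⊗_)
  open Algebra.Properties.Semiring.Mult.TCOptimised semiring using () renaming (_×_ to _⊗′_; ×ᵤ≈× to ⊗≈⊗′)
  open Relation.Binary.Reasoning.Setoid setoid

  private
    -- Cancelling common successors leaves one representative per integer, so that `_coefficient≟_`
    -- may compare pairs syntactically; otherwise (1 , 1) and (0 , 0) would count as different.
    reduced : ℕ × ℕ → ℕ × ℕ
    reduced (ℕ.suc m , ℕ.suc n) = reduced (m , n)
    reduced p                   = p

    -- The separate clause for a zero second component and the optimised multiple `_⊗′_` make
    -- `con (0 , 0)` and `con (1 , 0)` compute to `0#` and `1#` themselves, so solved equations
    -- match goals on the nose.
    ⟦_⟧ : ℕ × ℕ → Carrier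
    ⟦ m , ℕ.zero  ⟧ = m ⊗′ 1#
    ⟦ m , ℕ.suc n ⟧ = m ⊗′ 1# - ℕ.suc n ⊗′ 1#

    difference : ℕ × ℕ → Carrier
    difference (m , n) = m ⊗ 1# - n ⊗ 1#

    ⟦⟧≈difference : ∀ p → ⟦ p ⟧ ≈ difference p
    ⟦⟧≈difference (m , ℕ.zero) = begin
      m ⊗′ 1#          ≈⟨ ⊗≈⊗′ m 1# ⟨
      m ⊗ 1#           ≈⟨ +-identityʳ _ ⟨
      m ⊗ 1# + 0#      ≈⟨ +-congˡ ε⁻¹≈ε ⟨
      m ⊗ 1# + - 0#    ∎
    ⟦⟧≈difference (m , ℕ.suc n) = +-cong (sym (⊗≈⊗′ m 1#)) (-‿cong (sym (⊗≈⊗′ (ℕ.suc n) 1#)))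

    interchange : ∀ a b c d → (a + b) + (c + d) ≈ (a + c) + (b + d)
    interchange a b c d = begin
      (a + b) + (c + d)  ≈⟨ +-assoc a b _ ⟩
      a + (b + (c + d))  ≈⟨ +-congˡ (+-assoc b c d) ⟨
      a + (b + c + d)    ≈⟨ +-congˡ (+-congʳ (+-comm b c)) ⟩
      a + (c + b + d)    ≈⟨ +-congˡ (+-assoc c b d) ⟩
      a + (c + (b + d))  ≈⟨ +-assoc a c _ ⟨
      (a + c) + (b + d)  ∎

    difference-+ : ∀ m n m′ n′ → difference (m ℕ.+ m′ , n ℕ.+ n′) ≈ difference (m , n) + difference (m′ , n′)
    difference-+ m n m′ n′ = begin
      (m ℕ.+ m′) ⊗ 1# - (n ℕ.+ n′) ⊗ 1#
        ≈⟨ +-cong (×-homo-+ 1# m m′) (-‿cong (×-homo-+ 1# n n′)) ⟩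
      (m ⊗ 1# + m′ ⊗ 1#) - (n ⊗ 1# + n′ ⊗ 1#)
        ≈⟨ +-congˡ (⁻¹-∙-comm _ _) ⟨
      (m ⊗ 1# + m′ ⊗ 1#) + (- (n ⊗ 1#) + - (n′ ⊗ 1#))
        ≈⟨ interchange _ _ _ _ ⟩
      difference (m , n) + difference (m′ , n′) ∎

    difference-reduced : ∀ p → difference (reduced p) ≈ difference p
    difference-reduced (ℕ.zero  , n)       = refl
    difference-reduced (ℕ.suc m , ℕ.zero)  = refl
    difference-reduced (ℕ.suc m , ℕ.suc n) = begin
      difference (reduced (m , n))       ≈⟨ difference-reduced (m , n) ⟩
      difference (m , n)                 ≈⟨ +-identityˡ _ ⟨
      0# + difference (m , n)            ≈⟨ +-congʳ (-‿inverseʳ (1 ⊗ 1#)) ⟨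
      difference (1 , 1) + difference (m , n) ≈⟨ difference-+ 1 1 m n ⟨
      difference (ℕ.suc m , ℕ.suc n)     ∎

    ⟦reduced⟧ : ∀ p → ⟦ reduced p ⟧ ≈ difference p
    ⟦reduced⟧ p = trans (⟦⟧≈difference (reduced p)) (difference-reduced p)

    coefficients : RawRing _ _
    coefficients = record
      { Carrier = ℕ × ℕ
      ; _≈_     = _≡_
      ; _+_     = λ (m , n) (m′ , n′) → reduced (m ℕ.+ m′ , n ℕ.+ n′)
      ; _*_     = λ (m , n) (m′ , n′) → reduced (m ℕ.* m′ ℕ.+ n ℕ.* n′ , m ℕ.* n′ ℕ.+ n ℕ.* m′)
      ; -_      = λ (m , n) → n , m
      ; 0#      = 0 , 0
      ; 1#      = 1 , 0
      }

    difference-neg : ∀ m n → difference (n , m) ≈ - difference (m , n)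
    difference-neg m n = begin
      n ⊗ 1# + - (m ⊗ 1#)         ≈⟨ +-comm _ _ ⟩
      - (m ⊗ 1#) + n ⊗ 1#         ≈⟨ +-congˡ (⁻¹-involutive _) ⟨
      - (m ⊗ 1#) + - (- (n ⊗ 1#)) ≈⟨ ⁻¹-∙-comm _ _ ⟩
      - (m ⊗ 1# - n ⊗ 1#)         ∎

    difference-* : ∀ m n m′ n′ →
      difference (m ℕ.* m′ ℕ.+ n ℕ.* n′ , m ℕ.* n′ ℕ.+ n ℕ.* m′) ≈ difference (m , n) * difference (m′ , n′)
    difference-* m n m′ n′ = begin
      difference (m ℕ.* m′ ℕ.+ n ℕ.* n′ , m ℕ.* n′ ℕ.+ n ℕ.* m′)
        ≈⟨ difference-+ (m ℕ.* m′) (m ℕ.* n′) (n ℕ.* n′) (n ℕ.* m′) ⟩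
      difference (m ℕ.* m′ , m ℕ.* n′) + difference (n ℕ.* n′ , n ℕ.* m′)
        ≈⟨ +-cong (scale m m′ n′) (trans (difference-neg (n ℕ.* m′) (n ℕ.* n′))
            (trans (-‿cong (scale n m′ n′)) (-‿distribˡ-* _ _))) ⟩
      m ⊗ 1# * difference (m′ , n′) + - (n ⊗ 1#) * difference (m′ , n′)
        ≈⟨ distribʳ _ _ _ ⟨
      difference (m , n) * difference (m′ , n′) ∎
      where
      scale : ∀ k m n → difference (k ℕ.* m , k ℕ.* n) ≈ k ⊗ 1# * difference (m , n)
      scale k m n = begin
        (k ℕ.* m) ⊗ 1# - (k ℕ.* n) ⊗ 1#
          ≈⟨ +-cong (×1-homo-* k m) (trans (-‿cong (×1-homo-* k n)) (-‿distribʳ-* _ _)) ⟩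
        k ⊗ 1# * (m ⊗ 1#) + k ⊗ 1# * - (n ⊗ 1#)
          ≈⟨ distribˡ _ _ _ ⟨
        k ⊗ 1# * (m ⊗ 1# - n ⊗ 1#) ∎

    interpretation : coefficients -Raw-AlmostCommutative⟶ fromCommutativeRing R
    interpretation = record
      { ⟦_⟧    = ⟦_⟧
      ; +-homo = λ { p@(m , n) q@(m′ , n′) →
          trans (⟦reduced⟧ (m ℕ.+ m′ , n ℕ.+ n′))
            (trans (difference-+ m n m′ n′) (sym (+-cong (⟦⟧≈difference p) (⟦⟧≈difference q)))) }
      ; *-homo = λ { p@(m , n) q@(m′ , n′) →
          trans (⟦reduced⟧ (m ℕ.* m′ ℕ.+ n ℕ.* n′ , m ℕ.* n′ ℕ.+ n ℕ.* m′))
            (trans (difference-* m n m′ n′) (sym (*-cong (⟦⟧≈difference p) (⟦⟧≈difference q)))) }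
      ; -‿homo = λ { p@(m , n) →
          trans (⟦⟧≈difference (n , m)) (trans (difference-neg m n) (sym (-‿cong (⟦⟧≈difference p)))) }
      ; 0-homo = refl
      ; 1-homo = refl
      }

    _coefficient≟_ : ∀ p q → Maybe (⟦ p ⟧ ≈ ⟦ q ⟧)
    p coefficient≟ q with ≡-dec ℕₚ._≟_ ℕₚ._≟_ p q
    ... | yes ≡.refl = just refl
    ... | no _       = nothing

  open Algebra.Solver.Ring coefficients (fromCommutativeRing R) interpretation _coefficient≟_ public
    using (solve; _:=_; _:+_; _:*_; _:-_; :-_; con)

-- The pair (a , b) stands for a + b ε with ε² = 0.
module DualNumbers {r₁ r₂} (R : CommutativeRing r₁ r₂) where
  open CommutativeRing R
  open IntegerRingSolver R

  dualNumbers : CommutativeRing r₁ r₂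
  dualNumbers = record
    { Carrier = Carrier × Carrier
    ; _≈_     = Pointwise.Pointwise _≈_ _≈_
    ; _+_     = λ (a , b) (c , d) → a + c , b + d
    ; _*_     = λ (a , b) (c , d) → a * c , a * d + b * c
    ; -_      = λ (a , b) → - a , - b
    ; 0#      = 0# , 0#
    ; 1#      = 1# , 0#
    ; isCommutativeRing = record
      { isRing = record
        { +-isAbelianGroup = record
          { isGroup = record
            { isMonoid = record
              { isSemigroup = record
                { isMagma = record
                  { isEquivalence = Pointwise.×-isEquivalence isEquivalence isEquivalence
                  ; ∙-cong = λ (p , q) (p′ , q′) → +-cong p p′ , +-cong q q′
                  }
                ; assoc = λ x y z → +-assoc _ _ _ , +-assoc _ _ _
                }
              ; identity = (λ x → +-identityˡ _ , +-identityˡ _) , (λ x → +-identityʳ _ , +-identityʳ _)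
              }
            ; inverse = (λ x → -‿inverseˡ _ , -‿inverseˡ _) , (λ x → -‿inverseʳ _ , -‿inverseʳ _)
            ; ⁻¹-cong = λ (p , q) → -‿cong p , -‿cong q
            }
          ; comm = λ x y → +-comm _ _ , +-comm _ _
          }
        ; *-cong = λ (p , q) (p′ , q′) → *-cong p p′ , +-cong (*-cong p q′) (*-cong q p′)
        ; *-assoc = λ (a , b) (c , d) (e , f) → *-assoc _ _ _ ,
            solve 6 (λ a b c d e f → a :* c :* f :+ (a :* d :+ b :* c) :* e := a :* (c :* f :+ d :* e) :+ b :*
                (c :* e)) refl a b c d e f
        ; *-identity = (λ (a , b) → *-identityˡ _ , solve 2
              (λ a b → con (1 , 0) :* b :+ con (0 , 0) :* a := b) refl a b)
                     , (λ (a , b) → *-identityʳ _ , solve 2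
                           (λ a b → a :* con (0 , 0) :+ b :* con (1 , 0) := b) refl a b)
        ; distrib = (λ (a , b) (c , d) (e , f) → distribˡ _ _ _ ,
                       solve 6 (λ a b c d e f → a :* (d :+ f) :+ b :* (c :+ e) := (a :* d :+ b :* c) :+
                           (a :* f :+ b :* e)) refl a b c d e f)
                  , (λ (a , b) (c , d) (e , f) → distribʳ _ _ _ ,
                       solve 6 (λ a b c d e f → (c :+ e) :* b :+ (d :+ f) :* a := (c :* b :+ d :* a) :+
                           (e :* b :+ f :* a)) refl a b c d e f)
        }
      ; *-comm = λ (a , b) (c , d) → *-comm _ _ , solve 4
            (λ a b c d → a :* d :+ b :* c := c :* b :+ d :* a) refl a b c d
      }
    }

-- The ambient field under excluded middle

module FieldTheory (em : ∀ {a : Level} → ExcludedMiddle a) {c ℓ₁ ℓ₂ : Level} (Ω : HeytingField c ℓ₁ ℓ₂) where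
  open FieldExtensions em Ω public

  Ωᴿ : CommutativeRing c ℓ₁
  Ωᴿ = HeytingCommutativeRing.commutativeRing (HeytingField.heytingCommutativeRing Ω)

  open CommutativeRing Ωᴿ public hiding (rawRing; zero)
  open Algebra.Properties.Ring ring public using (-‿distribˡ-*)
  open Algebra.Properties.AbelianGroup +-abelianGroup public
    using () renaming (ε⁻¹≈ε to -0≈0; x∙y⁻¹≈ε⇒x≈y to x-y≈0⇒x≈y; x≈y⇒x∙y⁻¹≈ε to x≈y⇒x-y≈0)
  open IntegerRingSolver Ωᴿ public
  open Data.List.Relation.Unary.Unique.Setoid setoid public using (Unique)
  module ≈-Reasoning = Relation.Binary.Reasoning.Setoid setoid

  classical : ∀ {a} {P : Set a} → ¬ ¬ P → P
  classical {P = P} ¬¬p with em {P = P}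
  ... | yes p = p
  ... | no ¬p = ⊥-elim (¬¬p ¬p)

  x-0≈x : ∀ x → x - 0# ≈ x
  x-0≈x x = trans (+-congˡ -0≈0) (+-identityʳ x)

  invert : ∀ {x} → ¬ x ≈ 0# → ∃[ y ] x * y ≈ 1#
  invert {x} x≉0 with HeytingField.#⇒invertible Ω (classical λ ¬x#0 → x≉0 (proj₁ (HeytingField.tight Ω x 0#) ¬x#0))
  ... | y , _ , [x-0]y≈1 = y , trans (*-congʳ (sym (x-0≈x x))) [x-0]y≈1

  -- If the ring were zero, `0# - 0#` would be invertible and `0#` would be apart from itself.
  1≉0 : ¬ 1# ≈ 0#
  1≉0 1≈0 = proj₂ (HeytingField.tight Ω 0# 0#) refl
    (HeytingField.invertible⇒# Ω (0# , trans (≈0 _) (sym 1≈0) , trans (≈0 _) (sym 1≈0)))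
    where
    ≈0 : ∀ x → x ≈ 0#
    ≈0 x = trans (sym (*-identityˡ x)) (trans (*-congʳ 1≈0) (zeroˡ x))

  *-cancelˡ-nonZero : ∀ {x y} → ¬ x ≈ 0# → x * y ≈ 0# → y ≈ 0#
  *-cancelˡ-nonZero {x} {y} x≉0 xy≈0 with invert x≉0
  ... | x⁻¹ , xx⁻¹≈1 = begin
    y               ≈⟨ *-identityˡ y ⟨
    1# * y          ≈⟨ *-congʳ xx⁻¹≈1 ⟨
    x * x⁻¹ * y     ≈⟨ solve 3 (λ x z y → x :* z :* y := z :* (x :* y)) refl x x⁻¹ y ⟩
    x⁻¹ * (x * y)   ≈⟨ *-congˡ xy≈0 ⟩
    x⁻¹ * 0#        ≈⟨ zeroʳ x⁻¹ ⟩
    0#              ∎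
    where open ≈-Reasoning

  integral : ∀ {x y} → x * y ≈ 0# → x ≈ 0# ⊎ y ≈ 0#
  integral {x} xy≈0 with em {P = x ≈ 0#}
  ... | yes x≈0 = inj₁ x≈0
  ... | no  x≉0 = inj₂ (*-cancelˡ-nonZero x≉0 xy≈0)

  xy≈1⇒y≉0 : ∀ {x y} → x * y ≈ 1# → ¬ y ≈ 0#
  xy≈1⇒y≉0 xy≈1 y≈0 = 1≉0 (trans (sym xy≈1) (trans (*-congˡ y≈0) (zeroʳ _)))

  -- Arithmetic of coefficient lists

  coeff-⊞ : ∀ p q i → coeff (p ⊞ q) i ≈ coeff p i + coeff q i
  coeff-⊞ []      q       i         = sym (+-identityˡ _)
  coeff-⊞ (a ∷ p) []      i         = sym (+-identityʳ _)
  coeff-⊞ (a ∷ p) (b ∷ q) ℕ.zero    = refl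
  coeff-⊞ (a ∷ p) (b ∷ q) (ℕ.suc i) = coeff-⊞ p q i

  coeff-scale : ∀ a p i → coeff (map (a *_) p) i ≈ a * coeff p i
  coeff-scale a []      i         = sym (zeroʳ a)
  coeff-scale a (b ∷ p) ℕ.zero    = refl
  coeff-scale a (b ∷ p) (ℕ.suc i) = coeff-scale a p i

  DegreeBelow : ℕ → Polynomial → Set ℓ₁
  DegreeBelow n p = ∀ i → n ℕ.≤ i → coeff p i ≈ 0#

  module _ (E : Subfield) where
    open Subfield E hiding (∣_∣)

    coeff∈ : ∀ {p} → All ∣ E ∣ p → ∀ i → coeff p i ∈ ∣ E ∣
    coeff∈ []         i         = 0∈
    coeff∈ (a∈ ∷ p∈) ℕ.zero    = a∈
    coeff∈ (a∈ ∷ p∈) (ℕ.suc i) = coeff∈ p∈ i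

    ⊞-closed : ∀ {p q} → All ∣ E ∣ p → All ∣ E ∣ q → All ∣ E ∣ (p ⊞ q)
    ⊞-closed []        q∈        = q∈
    ⊞-closed (a∈ ∷ p∈) []        = a∈ ∷ p∈
    ⊞-closed (a∈ ∷ p∈) (b∈ ∷ q∈) = +-closed a∈ b∈ ∷ ⊞-closed p∈ q∈

    scale-closed : ∀ {a p} → a ∈ ∣ E ∣ → All ∣ E ∣ p → All ∣ E ∣ (map (a *_) p)
    scale-closed a∈ []        = []
    scale-closed a∈ (b∈ ∷ p∈) = *-closed a∈ b∈ ∷ scale-closed a∈ p∈

    ⊠-closed : ∀ {p q} → All ∣ E ∣ p → All ∣ E ∣ q → All ∣ E ∣ (p ⊠ q)
    ⊠-closed []        q∈ = []
    ⊠-closed (a∈ ∷ p∈) q∈ = ⊞-closed (scale-closed a∈ q∈) (0∈ ∷ ⊠-closed p∈ q∈)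

  -- As domain of the identity homomorphism this turns the evaluation laws below into unconditional
  -- identities in Ω.
  everything : Subfield
  everything = record
    { ∣_∣       = λ _ → Lift _ ⊤
    ; resp      = λ _ _ → _
    ; 0∈        = _
    ; 1∈        = _
    ; +-closed  = λ _ _ → _
    ; *-closed  = λ _ _ → _
    ; -‿closed  = λ _ → _
    ; ⁻¹-closed = λ _ _ → _
    }

  everything∋ : ∀ p → All ∣ everything ∣ p
  everything∋ p = All.universal (λ _ → lift _) p

  -- Homomorphisms from a subfield to a commutative ring

  module Homomorphisms {r ρ} (R : CommutativeRing r ρ) where
    private
      module R = CommutativeRing R
      module S = IntegerRingSolver R
      open Relation.Binary.Reasoning.Setoid R.setoid

    -- A homomorphism on E is a total function; its values outside E are junk.
    record IsHom (E : Subfield) (σ : Carrier → R.Carrier) : Set (c ⊔ ℓ₁ ⊔ ρ) where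
      field
        cong   : ∀ {x y} → x ∈ ∣ E ∣ → x ≈ y → σ x R.≈ σ y
        +-homo : ∀ {x y} → x ∈ ∣ E ∣ → y ∈ ∣ E ∣ → σ (x + y) R.≈ σ x R.+ σ y
        *-homo : ∀ {x y} → x ∈ ∣ E ∣ → y ∈ ∣ E ∣ → σ (x * y) R.≈ σ x R.* σ y
        1-homo : σ 1# R.≈ R.1#

      open Subfield E using (0∈; 1∈; -‿closed)
      private
        module RP = Algebra.Properties.Ring R.ring
        module AP = Algebra.Properties.AbelianGroup R.+-abelianGroup

      0-homo : σ 0# R.≈ R.0#
      0-homo = RP.x+x≈x⇒x≈0 _ (R.trans (R.sym (+-homo 0∈ 0∈)) (R.sym (cong 0∈ (sym (+-identityˡ 0#)))))

      -‿homo : ∀ {x} → x ∈ ∣ E ∣ → σ (- x) R.≈ R.- σ x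
      -‿homo {x} x∈ = AP.inverseˡ-unique _ _
        (R.trans (R.sym (+-homo (-‿closed x∈) x∈)) (R.trans (R.sym (cong 0∈ (sym (-‿inverseˡ x)))) 0-homo))

    evalAt : (Carrier → R.Carrier) → Polynomial → R.Carrier → R.Carrier
    evalAt σ p r = foldr (λ a v → σ a R.+ r R.* v) R.0# p

    evalAt-ext : ∀ E {σ τ : Carrier → R.Carrier} → (∀ {a} → a ∈ ∣ E ∣ → σ a R.≈ τ a) →
                 ∀ {p} → All ∣ E ∣ p → ∀ r → evalAt σ p r R.≈ evalAt τ p r
    evalAt-ext E σ≈τ []        r = R.refl
    evalAt-ext E σ≈τ (a∈ ∷ p∈) r = R.+-cong (σ≈τ a∈) (R.*-congˡ (evalAt-ext E σ≈τ p∈ r))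

    restrict : ∀ {E F σ} → F ≤ E → IsHom E σ → IsHom F σ
    restrict F≤E h = record
      { cong   = λ x∈ → cong (F≤E x∈)
      ; +-homo = λ x∈ y∈ → +-homo (F≤E x∈) (F≤E y∈)
      ; *-homo = λ x∈ y∈ → *-homo (F≤E x∈) (F≤E y∈)
      ; 1-homo = 1-homo
      }
      where open IsHom h

    module _ {E σ} (h : IsHom E σ) where
      open IsHom h
      open Subfield E hiding (∣_∣)

      evalAt-⊞ : ∀ {p q} → All ∣ E ∣ p → All ∣ E ∣ q → ∀ r →
                 evalAt σ (p ⊞ q) r R.≈ evalAt σ p r R.+ evalAt σ q r
      evalAt-⊞ []              q∈              r = R.sym (R.+-identityˡ _)
      evalAt-⊞ (a∈ ∷ p∈)       []              r = R.sym (R.+-identityʳ _)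
      evalAt-⊞ {a ∷ p} {b ∷ q} (a∈ ∷ p∈) (b∈ ∷ q∈) r = begin
        σ (a + b) R.+ r R.* evalAt σ (p ⊞ q) r
          ≈⟨ R.+-cong (+-homo a∈ b∈) (R.*-congˡ (evalAt-⊞ p∈ q∈ r)) ⟩
        σ a R.+ σ b R.+ r R.* (evalAt σ p r R.+ evalAt σ q r)
          ≈⟨ S.solve 5 (λ a b r u v → a S.:+ b S.:+ r S.:* (u S.:+ v) S.:= (a S.:+ r S.:* u) S.:+
              (b S.:+ r S.:* v)) R.refl _ _ _ _ _ ⟩
        (σ a R.+ r R.* evalAt σ p r) R.+ (σ b R.+ r R.* evalAt σ q r) ∎

      evalAt-scale : ∀ {a p} → a ∈ ∣ E ∣ → All ∣ E ∣ p → ∀ r →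
                     evalAt σ (map (a *_) p) r R.≈ σ a R.* evalAt σ p r
      evalAt-scale a∈ [] r = R.sym (R.zeroʳ _)
      evalAt-scale {a} {b ∷ p} a∈ (b∈ ∷ p∈) r = begin
        σ (a * b) R.+ r R.* evalAt σ (map (a *_) p) r
          ≈⟨ R.+-cong (*-homo a∈ b∈) (R.*-congˡ (evalAt-scale a∈ p∈ r)) ⟩
        σ a R.* σ b R.+ r R.* (σ a R.* evalAt σ p r)
          ≈⟨ S.solve 4 (λ a b r u → a S.:* b S.:+ r S.:* (a S.:* u) S.:= a S.:* (b S.:+ r S.:* u)) R.refl _ _ _ _ ⟩
        σ a R.* (σ b R.+ r R.* evalAt σ p r) ∎

      evalAt-⊠ : ∀ {p q} → All ∣ E ∣ p → All ∣ E ∣ q → ∀ r →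
                 evalAt σ (p ⊠ q) r R.≈ evalAt σ p r R.* evalAt σ q r
      evalAt-⊠ [] q∈ r = R.sym (R.zeroˡ _)
      evalAt-⊠ {a ∷ p} {q} (a∈ ∷ p∈) q∈ r = begin
        evalAt σ (map (a *_) q ⊞ (0# ∷ p ⊠ q)) r
          ≈⟨ evalAt-⊞ (scale-closed E a∈ q∈) (0∈ ∷ ⊠-closed E p∈ q∈) r ⟩
        evalAt σ (map (a *_) q) r R.+ (σ 0# R.+ r R.* evalAt σ (p ⊠ q) r)
          ≈⟨ R.+-cong (evalAt-scale a∈ q∈ r) (R.+-cong 0-homo (R.*-congˡ (evalAt-⊠ p∈ q∈ r))) ⟩
        σ a R.* evalAt σ q r R.+ (R.0# R.+ r R.* (evalAt σ p r R.* evalAt σ q r))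
          ≈⟨ S.solve 4 (λ a r u v → a S.:* v S.:+ (S.con (0 , 0) S.:+ r S.:* (u S.:* v)) S.:=
              (a S.:+ r S.:* u) S.:* v) R.refl _ _ _ _ ⟩
        (σ a R.+ r R.* evalAt σ p r) R.* evalAt σ q r ∎

      evalAt-≋[] : ∀ {p} → All ∣ E ∣ p → p ≋ [] → ∀ r → evalAt σ p r R.≈ R.0#
      evalAt-≋[] []        p≋[] r = R.refl
      evalAt-≋[] (a∈ ∷ p∈) p≋[] r =
        R.trans (R.+-cong (R.trans (cong a∈ (p≋[] 0)) 0-homo) (R.*-congˡ (evalAt-≋[] p∈ (λ i → p≋[] (ℕ.suc i)) r)))
          (R.trans (R.+-identityˡ _) (R.zeroʳ r))

      evalAt-≋ : ∀ {p q} → All ∣ E ∣ p → All ∣ E ∣ q → p ≋ q → ∀ r → evalAt σ p r R.≈ evalAt σ q r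
      evalAt-≋ []        q∈ p≋q r = R.sym (evalAt-≋[] q∈ (λ i → sym (p≋q i)) r)
      evalAt-≋ (a∈ ∷ p∈) [] p≋q r = evalAt-≋[] (a∈ ∷ p∈) p≋q r
      evalAt-≋ (a∈ ∷ p∈) (b∈ ∷ q∈) p≋q r =
        R.+-cong (cong a∈ (p≋q 0)) (R.*-congˡ (evalAt-≋ p∈ q∈ (λ i → p≋q (ℕ.suc i)) r))

      eval∈ : ∀ {p x} → All ∣ E ∣ p → x ∈ ∣ E ∣ → eval p x ∈ ∣ E ∣
      eval∈ []        x∈ = 0∈
      eval∈ (a∈ ∷ p∈) x∈ = +-closed a∈ (*-closed x∈ (eval∈ p∈ x∈))

      hom-eval : ∀ {p x} → All ∣ E ∣ p → x ∈ ∣ E ∣ → σ (eval p x) R.≈ evalAt σ p (σ x)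
      hom-eval []        x∈ = 0-homo
      hom-eval (a∈ ∷ p∈) x∈ =
        R.trans (+-homo a∈ (*-closed x∈ (eval∈ p∈ x∈)))
          (R.+-congˡ (R.trans (*-homo x∈ (eval∈ p∈ x∈)) (R.*-congˡ (hom-eval p∈ x∈))))

  module Self = Homomorphisms Ωᴿ

  id-hom : ∀ E → Self.IsHom E id
  id-hom E = record { cong = λ _ x≈y → x≈y ; +-homo = λ _ _ → refl ; *-homo = λ _ _ → refl ; 1-homo = refl }

  eval-⊞ : ∀ p q x → eval (p ⊞ q) x ≈ eval p x + eval q x
  eval-⊞ p q = Self.evalAt-⊞ (id-hom everything) (everything∋ p) (everything∋ q)

  eval-scale : ∀ a p x → eval (map (a *_) p) x ≈ a * eval p x
  eval-scale a p = Self.evalAt-scale (id-hom everything) (lift _) (everything∋ p)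

  eval-⊠ : ∀ p q x → eval (p ⊠ q) x ≈ eval p x * eval q x
  eval-⊠ p q = Self.evalAt-⊠ (id-hom everything) (everything∋ p) (everything∋ q)

  eval-≋ : ∀ {p q} → p ≋ q → ∀ x → eval p x ≈ eval q x
  eval-≋ {p} {q} = Self.evalAt-≋ (id-hom everything) (everything∋ p) (everything∋ q)

  split-≤ : ∀ {n i} {P : ℕ → Set ℓ₁} → P n → (∀ j → n ℕ.< j → P j) → n ℕ.≤ i → P i
  split-≤ {n} {i} Pn P> n≤i with ℕₚ.m≤n⇒m<n∨m≡n n≤i
  ... | inj₁ n<i    = P> i n<i
  ... | inj₂ ≡.refl = Pn

  -- Reduction modulo a monic polynomial

  module Reduction {r ρ} (R : CommutativeRing r ρ) where
    private module R = CommutativeRing R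
    open Homomorphisms R
    open Relation.Binary.Reasoning.Setoid R.setoid

    module _ {E σ} (h : IsHom E σ) {x n f} (ann : IsMonicAnnihilator E x n f)
             {r} (fr≈0 : evalAt σ f r R.≈ R.0#) where
      open Subfield E hiding (∣_∣)
      private
        f∈ = proj₁ ann
        monic = proj₁ (proj₁ (proj₂ ann))
        above = proj₂ (proj₁ (proj₂ ann))
        fx≈0 = proj₂ (proj₂ ann)

      -- Division with remainder in Horner order: after prepending a coefficient to the remainder,
      -- its coefficient at `n` is removed by subtracting a multiple of `f`. The quotient is not
      -- recorded; since `f` vanishes both at `x` and, through `σ`, at `r`, both values survive each
      -- subtraction.
      reduce : ∀ {g} → All ∣ E ∣ g →
               Σ[ t ∈ Polynomial ] All ∣ E ∣ t × DegreeBelow n t × eval g x ≈ eval t x × evalAt σ g r R.≈ evalAt σ t r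
      reduce [] = [] , [] , (λ _ _ → refl) , refl , R.refl
      reduce {a ∷ g} (a∈ ∷ g∈) with reduce g∈
      ... | t , t∈ , deg , gx≈tx , gr≈tr = u , u∈ , u-degree , x-eval , r-eval
        where
        s = a ∷ t
        s∈ = a∈ ∷ t∈
        k = coeff s n
        k∈ = -‿closed (coeff∈ E s∈ n)
        u = s ⊞ map (- k *_) f
        kf∈ = scale-closed E k∈ f∈
        u∈ = ⊞-closed E s∈ kf∈
        coeff-u : ∀ i → coeff u i ≈ coeff s i + - k * coeff f i
        coeff-u i = trans (coeff-⊞ s (map (- k *_) f) i) (+-congˡ (coeff-scale (- k) f i))
        u-degree : DegreeBelow n u
        u-degree i n≤i = trans (coeff-u i) (split-≤ {P = λ i → coeff s i + - k * coeff f i ≈ 0#}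
          (trans (+-congˡ (trans (*-congˡ monic) (*-identityʳ _))) (-‿inverseʳ k))
          (λ { (ℕ.suc j) (s≤s n≤j) → trans (+-cong (deg j n≤j) (trans (*-congˡ (above (ℕ.suc j) (s≤s n≤j))) (zeroʳ _)))
              (+-identityʳ 0#) })
          n≤i)
        x-eval : a + x * eval g x ≈ eval u x
        x-eval = trans (+-congˡ (*-congˡ gx≈tx)) (sym (trans (eval-⊞ s (map (- k *_) f) x)
          (trans (+-congˡ (trans (eval-scale (- k) f x) (trans (*-congˡ fx≈0) (zeroʳ _)))) (+-identityʳ _))))
        r-eval : σ a R.+ r R.* evalAt σ g r R.≈ evalAt σ u r
        r-eval = R.trans (R.+-congˡ (R.*-congˡ gr≈tr)) (R.sym (R.trans (evalAt-⊞ h s∈ kf∈ r)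
          (R.trans (R.+-congˡ (R.trans (evalAt-scale h k∈ f∈ r) (R.trans (R.*-congˡ fr≈0) (R.zeroʳ _))))
              (R.+-identityʳ _))))

  -- The degree bound `k` is lowered one coefficient at a time: a nonzero top coefficient could be
  -- scaled to 1, giving a monic annihilator of degree below the minimal `n`.
  below-minimal : ∀ {E x n} → (∀ m q → IsMonicAnnihilator E x m q → n ℕ.≤ m) →
                  ∀ k → k ℕ.≤ n → ∀ {t} → All ∣ E ∣ t → DegreeBelow k t → eval t x ≈ 0# → t ≋ []
  below-minimal minimal ℕ.zero k≤n t∈ deg tx≈0 i = deg i z≤n
  below-minimal {E} {x} minimal (ℕ.suc k) k<n {t} t∈ deg tx≈0 with em {P = coeff t k ≈ 0#}
  ... | yes tk≈0 = below-minimal {E} {x} minimal k (ℕₚ.<⇒≤ k<n) t∈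
        (λ i → split-≤ {P = λ i → coeff t i ≈ 0#} tk≈0 deg) tx≈0
  ... | no tk≉0 with invert tk≉0
  ...   | a , tk*a≈1 = contradiction k<n (ℕₚ.≤⇒≯ (minimal k (map (a *_) t)
          ( scale-closed E (Subfield.⁻¹-closed E (coeff∈ E t∈ k) tk*a≈1) t∈
          , ( trans (coeff-scale a t k) (trans (*-comm a _) tk*a≈1)
            , λ i k<i → trans (coeff-scale a t i) (trans (*-congˡ (deg i k<i)) (zeroʳ a)))
          , trans (eval-scale a t x) (trans (*-congˡ tx≈0) (zeroʳ a)))))

  module _ {r ρ} (R : CommutativeRing r ρ) where
    private module R = CommutativeRing R
    open Homomorphisms R
    open Reduction R

    -- This takes the place of the isomorphism between E[X]/(f) and E(x): the remainder of `g`
    -- modulo `f` has too small a degree to vanish at `x` unless it is zero, so `g` also vanishes at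
    -- any root `r` of the image of `f`, in whatever ring `r` lives.
    relation-transfers : ∀ {E σ} → IsHom E σ → ∀ {x f} → IsMinimalPolynomial E x f →
                         ∀ {r} → evalAt σ f r R.≈ R.0# →
                         ∀ {g} → All ∣ E ∣ g → eval g x ≈ 0# → evalAt σ g r R.≈ R.0#
    relation-transfers {E} h {x} (n , ann , minimal) {r} fr≈0 g∈ gx≈0 with reduce h ann fr≈0 g∈
    ... | t , t∈ , deg , gx≈tx , gr≈tr =
      R.trans gr≈tr (evalAt-≋[] h t∈ (below-minimal {E} {x} minimal n ℕₚ.≤-refl t∈ deg (trans (sym gx≈tx) gx≈0)) r)

  minimalPolynomial : ∀ E {x} → AlgebraicOver E x → ∃ (IsMinimalPolynomial E x)
  minimalPolynomial E {x} (n , p , ann) = <-rec _ step n p ann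
    where
    step : ∀ n → (∀ {m} → m ℕ.< n → ∀ p → IsMonicAnnihilator E x m p → ∃ (IsMinimalPolynomial E x)) →
           ∀ p → IsMonicAnnihilator E x n p → ∃ (IsMinimalPolynomial E x)
    step n rec p ann with em {P = ∃[ m ] m ℕ.< n × ∃[ q ] IsMonicAnnihilator E x m q}
    ... | yes (m , m<n , q , q-ann) = rec m<n q q-ann
    ... | no none = p , n , ann , λ m q q-ann → ℕₚ.≮⇒≥ λ m<n → none (m , m<n , q , q-ann)

  algebraic-mono : ∀ {K E x} → K ≤ E → AlgebraicOver K x → AlgebraicOver E x
  algebraic-mono K≤E (n , p , p∈ , rest) = n , p , All.map K≤E p∈ , rest

  -- Splitting into linear factors

  linear : Carrier → Polynomial
  linear r = - r ∷ 1# ∷ []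

  coeff-linear-⊠₀ : ∀ r q → coeff (linear r ⊠ q) 0 ≈ - r * coeff q 0
  coeff-linear-⊠₀ r q = trans (coeff-⊞ (map (- r *_) q) _ 0)
      (trans (+-cong (coeff-scale (- r) q 0) refl) (+-identityʳ _))

  coeff-linear-⊠ : ∀ r q i → coeff (linear r ⊠ q) (ℕ.suc i) ≈ - r * coeff q (ℕ.suc i) + coeff q i
  coeff-linear-⊠ r q i = trans (coeff-⊞ (map (- r *_) q) _ (ℕ.suc i)) (+-cong (coeff-scale (- r) q (ℕ.suc i)) (begin
      coeff (map (1# *_) q ⊞ (0# ∷ [])) i      ≈⟨ coeff-⊞ (map (1# *_) q) (0# ∷ []) i ⟩
      coeff (map (1# *_) q) i + coeff (0# ∷ []) i ≈⟨ +-cong (trans (coeff-scale 1# q i) (*-identityˡ _)) (coeff-0 i) ⟩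
      coeff q i + 0#                           ≈⟨ +-identityʳ _ ⟩
      coeff q i                                ∎))
    where
    open ≈-Reasoning
    coeff-0 : ∀ i → coeff (0# ∷ []) i ≈ 0#
    coeff-0 ℕ.zero    = refl
    coeff-0 (ℕ.suc i) = refl

  linear-⊠-cong : ∀ r {p q} → p ≋ q → linear r ⊠ p ≋ linear r ⊠ q
  linear-⊠-cong r {p} {q} p≋q ℕ.zero = trans (coeff-linear-⊠₀ r p) (trans (*-congˡ (p≋q 0)) (sym (coeff-linear-⊠₀ r q)))
  linear-⊠-cong r {p} {q} p≋q (ℕ.suc i) = trans (coeff-linear-⊠ r p i)
    (trans (+-cong (*-congˡ (p≋q (ℕ.suc i))) (p≋q i)) (sym (coeff-linear-⊠ r q i)))

  -- Synthetic division by X - r: the Horner values of the proper tails of `p` are the coefficients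
  -- of the quotient, and `eval p r` is the remainder.
  quotient : Carrier → Polynomial → Polynomial
  quotient r []      = []
  quotient r (a ∷ p) = eval p r ∷ quotient r p

  coeff₀-quotient : ∀ r p → coeff p 0 ≈ - r * coeff (quotient r p) 0 + eval p r
  coeff₀-quotient r []      = sym (trans (+-identityʳ _) (zeroʳ _))
  coeff₀-quotient r (a ∷ p) = solve 3 (λ a r v → a := :- r :* v :+ (a :+ r :* v)) refl a r (eval p r)

  coeff-quotient : ∀ r p i → coeff p (ℕ.suc i) ≈ - r * coeff (quotient r p) (ℕ.suc i) + coeff (quotient r p) i
  coeff-quotient r []      i         = sym (trans (+-identityʳ _) (zeroʳ _))
  coeff-quotient r (a ∷ p) ℕ.zero    = coeff₀-quotient r p
  coeff-quotient r (a ∷ p) (ℕ.suc i) = coeff-quotient r p i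

  factor : ∀ {p r} → eval p r ≈ 0# → p ≋ linear r ⊠ quotient r p
  factor {p} {r} pr≈0 ℕ.zero = trans (coeff₀-quotient r p)
    (trans (+-congˡ pr≈0) (trans (+-identityʳ _) (sym (coeff-linear-⊠₀ r (quotient r p)))))
  factor {p} {r} pr≈0 (ℕ.suc i) = trans (coeff-quotient r p i) (sym (coeff-linear-⊠ r (quotient r p) i))

  quotient-degree : ∀ n r p → DegreeBelow (ℕ.suc n) p → DegreeBelow n (quotient r p)
  quotient-degree n         r []      deg i         n≤i       = refl
  quotient-degree ℕ.zero    r (a ∷ p) deg ℕ.zero    n≤i       = eval-≋ {p} {[]} (λ i → deg (ℕ.suc i) (s≤s z≤n)) r
  quotient-degree ℕ.zero    r (a ∷ p) deg (ℕ.suc i) n≤i       =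
      quotient-degree ℕ.zero r p (λ j _ → deg (ℕ.suc j) (s≤s z≤n)) i z≤n
  quotient-degree (ℕ.suc n) r (a ∷ p) deg (ℕ.suc i) (s≤s n≤i) =
      quotient-degree n r p (λ j n<j → deg (ℕ.suc j) (s≤s n<j)) i n≤i

  quotient-monic : ∀ n r p → MonicOfDegree (ℕ.suc n) p → MonicOfDegree n (quotient r p)
  quotient-monic n r p (monic , above) = (begin
      coeff q n                               ≈⟨ +-identityˡ _ ⟨
      0# + coeff q n                          ≈⟨ +-congʳ (trans (*-congˡ (above′ (ℕ.suc n) (ℕₚ.n<1+n n))) (zeroʳ _)) ⟨
      - r * coeff q (ℕ.suc n) + coeff q n     ≈⟨ coeff-quotient r p n ⟨
      coeff p (ℕ.suc n)                       ≈⟨ monic ⟩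
      1#                                      ∎)
    , above′
    where
    open ≈-Reasoning
    q = quotient r p
    above′ : DegreeBelow (ℕ.suc n) q
    above′ = quotient-degree (ℕ.suc n) r p above

  splits : AlgebraicallyClosed → ∀ n p → MonicOfDegree n p → ∃[ rs ] p ≋ fromRoots rs
  splits closed ℕ.zero p (monic , above) = [] , λ { ℕ.zero → monic ; (ℕ.suc i) → above (ℕ.suc i) (s≤s z≤n) }
  splits closed (ℕ.suc n) p p-monic with closed n p p-monic
  ... | r , pr≈0 with splits closed n (quotient r p) (quotient-monic n r p p-monic)
  ...   | rs , q≋ = r ∷ rs , λ i → trans (factor {p} pr≈0 i) (linear-⊠-cong r {quotient r p} {fromRoots rs} q≋ i)

  eval-linear : ∀ r x → eval (linear r) x ≈ x - r
  eval-linear r x = solve 2 (λ r x → :- r :+ x :* (con (1 , 0) :+ x :* con (0 , 0)) := x :- r) refl r x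

  eval-fromRoots-∷ : ∀ r rs x → eval (fromRoots (r ∷ rs)) x ≈ (x - r) * eval (fromRoots rs) x
  eval-fromRoots-∷ r rs x = trans (eval-⊠ (linear r) (fromRoots rs) x) (*-congʳ (eval-linear r x))

  eval-fromRoots-[] : ∀ x → eval (fromRoots []) x ≈ 1#
  eval-fromRoots-[] x = trans (+-congˡ (zeroʳ x)) (+-identityʳ 1#)

  fromRoots-root : ∀ {rs x} → Any (x ≈_) rs → eval (fromRoots rs) x ≈ 0#
  fromRoots-root {r ∷ rs} {x} (here x≈r) = trans (eval-fromRoots-∷ r rs x) (trans (*-congʳ (x≈y⇒x-y≈0 x≈r)) (zeroˡ _))
  fromRoots-root {r ∷ rs} {x} (there x∈) = trans (eval-fromRoots-∷ r rs x)
      (trans (*-congˡ (fromRoots-root x∈)) (zeroʳ _))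

  root∈fromRoots : ∀ rs {x} → eval (fromRoots rs) x ≈ 0# → Any (x ≈_) rs
  root∈fromRoots []       {x} px≈0 = ⊥-elim (1≉0 (trans (sym (eval-fromRoots-[] x)) px≈0))
  root∈fromRoots (r ∷ rs) {x} px≈0 =
    [ (λ x-r≈0 → here (x-y≈0⇒x≈y x r x-r≈0)) , (λ qx≈0 → there (root∈fromRoots rs qx≈0)) ]′
      (integral {x - r} {eval (fromRoots rs) x} (trans (sym (eval-fromRoots-∷ r rs x)) px≈0))

  module _ {E σ} (h : Self.IsHom E σ) where
    open Self.IsHom h
    open Subfield E hiding (∣_∣)

    hom-reflects-0 : ∀ {x} → x ∈ ∣ E ∣ → σ x ≈ 0# → x ≈ 0#
    hom-reflects-0 {x} x∈ σx≈0 = classical λ x≉0 →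
      let y , xy≈1 = invert x≉0
          y∈ = ⁻¹-closed x∈ xy≈1
      in 1≉0 (begin
        1#        ≈⟨ 1-homo ⟨
        σ 1#      ≈⟨ cong 1∈ (sym xy≈1) ⟩
        σ (x * y) ≈⟨ *-homo x∈ y∈ ⟩
        σ x * σ y ≈⟨ *-congʳ σx≈0 ⟩
        0# * σ y  ≈⟨ zeroˡ _ ⟩
        0#        ∎)
      where open ≈-Reasoning

    hom-injective : ∀ {x y} → x ∈ ∣ E ∣ → y ∈ ∣ E ∣ → σ x ≈ σ y → x ≈ y
    hom-injective x∈ y∈ σx≈σy = x-y≈0⇒x≈y _ _ (hom-reflects-0 (+-closed x∈ (-‿closed y∈))
      (trans (+-homo x∈ (-‿closed y∈)) (trans (+-congˡ (-‿homo y∈)) (x≈y⇒x-y≈0 σx≈σy))))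

    evalAt≈eval-map : ∀ p r → Self.evalAt σ p r ≈ eval (map σ p) r
    evalAt≈eval-map []      r = refl
    evalAt≈eval-map (a ∷ p) r = +-congˡ (*-congˡ (evalAt≈eval-map p r))

    coeff-map : ∀ {p} → All ∣ E ∣ p → ∀ i → coeff (map σ p) i ≈ σ (coeff p i)
    coeff-map []        i         = sym 0-homo
    coeff-map (a∈ ∷ p∈) ℕ.zero    = refl
    coeff-map (a∈ ∷ p∈) (ℕ.suc i) = coeff-map p∈ i

    map-monic : ∀ {n p} → All ∣ E ∣ p → MonicOfDegree n p → MonicOfDegree n (map σ p)
    map-monic {n} p∈ (monic , above) =
      trans (coeff-map p∈ n) (trans (cong (coeff∈ E p∈ n) monic) 1-homo) ,
      λ i n<i → trans (coeff-map p∈ i) (trans (cong (coeff∈ E p∈ i) (above i n<i)) 0-homo)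

  monic-degree0-nonzero : ∀ {p x} → MonicOfDegree 0 p → ¬ eval p x ≈ 0#
  monic-degree0-nonzero {p} {x} (monic , above) px≈0 = 1≉0 (trans (sym (eval-fromRoots-[] x))
    (trans (eval-≋ {fromRoots []} {p} (λ { ℕ.zero → sym monic ; (ℕ.suc i) → sym (above (ℕ.suc i) (s≤s z≤n)) }) x) px≈0))

  conjugate-exists : AlgebraicallyClosed → ∀ {E σ} → Self.IsHom E σ → ∀ {x n f} → IsMonicAnnihilator E x n f →
                     ∃[ r ] Self.evalAt σ f r ≈ 0#
  conjugate-exists closed h {n = ℕ.zero} {f} (f∈ , f-monic , fx≈0) = ⊥-elim (monic-degree0-nonzero {f} f-monic fx≈0)
  conjugate-exists closed {σ = σ} h {n = ℕ.suc n} {f} (f∈ , f-monic , _) with closed n (map σ f)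
      (map-monic h f∈ f-monic)
  ... | r , e = r , trans (evalAt≈eval-map h f r) e

  -- Intermediate fields and simple extensions

  module Closure (K : Subfield) (closure : IsAlgebraicClosureOf K) where

    algebraic : ∀ {E} → K ≤ E → ∀ x → AlgebraicOver E x
    algebraic {E} K≤E x = algebraic-mono {K} {E} K≤E (proj₂ closure x)

    minimal : ∀ {E} → K ≤ E → ∀ x → ∃ (IsMinimalPolynomial E x)
    minimal {E} K≤E x = minimalPolynomial E (algebraic {E} K≤E x)

    roots : ∀ {E x p} → IsMinimalPolynomial E x p → ∃[ rs ] p ≋ fromRoots rs
    roots {p = p} (n , (_ , p-monic , _) , _) = splits (proj₁ closure) n p p-monic

    module _ (A : Pred Carrier (c ⊔ ℓ₁)) (A-resp : A Respects _≈_) (K⊆A : ∣ K ∣ ⊆ A)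
             (A-+ : ∀ {x y} → x ∈ A → y ∈ A → x + y ∈ A) (A-* : ∀ {x y} → x ∈ A → y ∈ A → x * y ∈ A) where
      private
        module K = Subfield K

        A-eval : ∀ {p x} → All ∣ K ∣ p → x ∈ A → eval p x ∈ A
        A-eval []        x∈ = K⊆A K.0∈
        A-eval (a∈ ∷ p∈) x∈ = A-+ (K⊆A a∈) (A-* x∈ (A-eval p∈ x∈))

        -- A subring containing `K` is a field because its elements are algebraic: from a + x v = 0
        -- with a nonzero, the inverse of x is - v / a, a polynomial in x. If a = 0, the factor x is
        -- cancelled and a shorter relation remains.
        A-inverse : ∀ {x y} → x ∈ A → x * y ≈ 1# → ∀ {p} → All ∣ K ∣ p → eval p x ≈ 0# → ¬ p ≋ [] → y ∈ A
        A-inverse x∈ xy≈1 [] _ p≉[] = ⊥-elim (p≉[] λ _ → refl)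
        A-inverse {x} {y} x∈ xy≈1 {a ∷ p} (a∈ ∷ p∈) px≈0 p≉[] with em {P = a ≈ 0#}
        ... | yes a≈0 = A-inverse x∈ xy≈1 p∈
                (*-cancelˡ-nonZero (xy≈1⇒y≉0 (trans (*-comm y x) xy≈1))
                    (trans (sym (trans (+-congʳ a≈0) (+-identityˡ _))) px≈0))
                (λ p≋[] → p≉[] λ { ℕ.zero → a≈0 ; (ℕ.suc i) → p≋[] i })
        ... | no a≉0 with invert a≉0
        ...   | b , ab≈1 = A-resp (begin
                  - b * v                        ≈⟨ solve 2
                      (λ b v → :- b :* v := :- (b :* (con (1 , 0) :* v))) refl b v ⟩
                  - (b * (1# * v))               ≈⟨ -‿cong (*-congˡ (*-congʳ xy≈1)) ⟨
                  - (b * (x * y * v))            ≈⟨ solve 5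
                      (λ a b x y v → :- (b :* (x :* y :* v)) := (a :* b) :* y :- b :* y :*
                      (a :+ x :* v)) refl a b x y v ⟩
                  a * b * y - b * y * (a + x * v) ≈⟨ +-cong (*-congʳ ab≈1) (-‿cong (*-congˡ px≈0)) ⟩
                  1# * y - b * y * 0#            ≈⟨ solve 2
                      (λ b y → con (1 , 0) :* y :- b :* y :* con (0 , 0) := y) refl b y ⟩
                  y                              ∎)
                (A-* (K⊆A (K.-‿closed (K.⁻¹-closed a∈ ab≈1))) (A-eval p∈ x∈))
          where
          open ≈-Reasoning
          v = eval p x

      intermediateField : Subfield
      intermediateField = record
        { ∣_∣       = A
        ; resp      = A-resp
        ; 0∈        = K⊆A K.0∈
        ; 1∈        = K⊆A K.1∈
        ; +-closed  = A-+
        ; *-closed  = A-*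
        ; -‿closed  = λ {x} x∈ → A-resp (trans (sym (-‿distribˡ-* 1# x)) (-‿cong (*-identityˡ x)))
              (A-* (K⊆A (K.-‿closed K.1∈)) x∈)
        ; ⁻¹-closed = λ {x} x∈ xy≈1 → let n , p , p∈ , (monic , _) , px≈0 = proj₂ closure x in
            A-inverse x∈ xy≈1 p∈ px≈0 (λ p≋[] → 1≉0 (trans (sym monic) (p≋[] n)))
        }

    module _ (E : Subfield) (K≤E : K ≤ E) (x : Carrier) where
      private module E = Subfield E

      adjoin : Subfield
      adjoin = intermediateField (λ y → ∃[ p ] All ∣ E ∣ p × eval p x ≈ y)
        (λ y≈z (p , p∈ , px≈y) → p , p∈ , trans px≈y y≈z)
        (λ {a} a∈ → (a ∷ []) , (K≤E a∈ ∷ []) , trans (+-congˡ (zeroʳ x)) (+-identityʳ a))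
        (λ (p , p∈ , px≈y) (q , q∈ , qx≈z) → p ⊞ q , ⊞-closed E p∈ q∈ , trans (eval-⊞ p q x) (+-cong px≈y qx≈z))
        (λ (p , p∈ , px≈y) (q , q∈ , qx≈z) → p ⊠ q , ⊠-closed E p∈ q∈ , trans (eval-⊠ p q x) (*-cong px≈y qx≈z))

      E≤adjoin : E ≤ adjoin
      E≤adjoin {a} a∈ = (a ∷ []) , (a∈ ∷ []) , trans (+-congˡ (zeroʳ x)) (+-identityʳ a)

      x∈adjoin : x ∈ ∣ adjoin ∣
      x∈adjoin = (0# ∷ 1# ∷ []) , (E.0∈ ∷ E.1∈ ∷ []) ,
        solve 1 (λ x → con (0 , 0) :+ x :* (con (1 , 0) :+ x :* con (0 , 0)) := x) refl x

      adjoin-least : ∀ {F} → E ≤ F → x ∈ ∣ F ∣ → adjoin ≤ F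
      adjoin-least {F} E≤F x∈ (p , p∈ , px≈y) = Subfield.resp F px≈y (Self.eval∈ (id-hom F) (All.map E≤F p∈) x∈)

      module _ {r ρ} (R : CommutativeRing r ρ) {σ : Carrier → CommutativeRing.Carrier R} (h : Homomorphisms.IsHom R E σ)
               {f} (f-minimal : IsMinimalPolynomial E x f) {s : CommutativeRing.Carrier R} where
        private module R = CommutativeRing R
        open Homomorphisms R
        open IsHom h

        module _ (fs≈0 : evalAt σ f s R.≈ R.0#) where
          -- Excluded middle supplies some polynomial expression of `y` in `x`; `evalAt-unique`
          -- shows that the value does not depend on which one. Outside E(x) the value is junk.
          extend : Carrier → R.Carrier
          extend y with em {P = y ∈ ∣ adjoin ∣}
          ... | yes (p , _) = evalAt σ p s
          ... | no _        = R.0#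

          private
            evalAt-unique : ∀ {p q} → All ∣ E ∣ p → All ∣ E ∣ q → eval p x ≈ eval q x → evalAt σ p s R.≈ evalAt σ q s
            evalAt-unique {p} {q} p∈ q∈ px≈qx = RP.x∙y⁻¹≈ε⇒x≈y _ _ (begin
                evalAt σ p s R.- evalAt σ q s
                  ≈⟨ S.solve 2 (λ a b → a S.:- b S.:= a S.:+ (S.:- S.con (1 , 0)) S.:* b) R.refl _ _ ⟩
                evalAt σ p s R.+ (R.- R.1#) R.* evalAt σ q s
                  ≈⟨ R.+-congˡ (R.*-congʳ (R.trans (-‿homo E.1∈) (R.-‿cong 1-homo))) ⟨
                evalAt σ p s R.+ σ (- 1#) R.* evalAt σ q s
                  ≈⟨ R.trans (evalAt-⊞ h p∈ q-∈ s) (R.+-congˡ (evalAt-scale h (E.-‿closed E.1∈) q∈ s)) ⟨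
                evalAt σ (p ⊞ map (- 1# *_) q) s
                  ≈⟨ relation-transfers R h f-minimal fs≈0 (⊞-closed E p∈ q-∈)
                       (trans (eval-⊞ p (map (- 1# *_) q) x) (trans (+-cong px≈qx (eval-scale (- 1#) q x))
                         (solve 1 (λ v → v :+ (:- con (1 , 0)) :* v := con (0 , 0)) refl (eval q x)))) ⟩
                R.0# ∎)
              where
              module RP = Algebra.Properties.AbelianGroup R.+-abelianGroup
              module S = IntegerRingSolver R
              open Relation.Binary.Reasoning.Setoid R.setoid
              q-∈ = scale-closed E (E.-‿closed E.1∈) q∈

          extend-eval : ∀ {p y} → All ∣ E ∣ p → eval p x ≈ y → extend y R.≈ evalAt σ p s
          extend-eval {p} {y} p∈ px≈y with em {P = y ∈ ∣ adjoin ∣}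
          ... | yes (q , q∈ , qx≈y) = evalAt-unique q∈ p∈ (trans qx≈y (sym px≈y))
          ... | no y∉ = ⊥-elim (y∉ (p , p∈ , px≈y))

          extend-agrees : ∀ {a} → a ∈ ∣ E ∣ → extend a R.≈ σ a
          extend-agrees {a} a∈ = R.trans (extend-eval (a∈ ∷ []) (trans (+-congˡ (zeroʳ x)) (+-identityʳ a)))
            (R.trans (R.+-congˡ (R.zeroʳ s)) (R.+-identityʳ _))

          extend-isHom : IsHom adjoin extend
          extend-isHom = record
            { cong   = λ { (p , p∈ , px≈y) y≈z → R.trans (extend-eval p∈ px≈y)
                (R.sym (extend-eval p∈ (trans px≈y y≈z))) }
            ; +-homo = λ { (p , p∈ , px≈y) (q , q∈ , qx≈z) → R.trans
                  (extend-eval (⊞-closed E p∈ q∈) (trans (eval-⊞ p q x) (+-cong px≈y qx≈z)))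
                (R.trans (evalAt-⊞ h p∈ q∈ s) (R.sym (R.+-cong (extend-eval p∈ px≈y) (extend-eval q∈ qx≈z)))) }
            ; *-homo = λ { (p , p∈ , px≈y) (q , q∈ , qx≈z) → R.trans
                  (extend-eval (⊠-closed E p∈ q∈) (trans (eval-⊠ p q x) (*-cong px≈y qx≈z)))
                (R.trans (evalAt-⊠ h p∈ q∈ s) (R.sym (R.*-cong (extend-eval p∈ px≈y) (extend-eval q∈ qx≈z)))) }
            ; 1-homo = R.trans (extend-agrees E.1∈) 1-homo
            }

          extend-x : extend x R.≈ s
          extend-x = R.trans (extend-eval (proj₁ (proj₂ x∈adjoin)) (proj₂ (proj₂ x∈adjoin)))
            (R.trans (R.+-cong 0-homo (R.*-congˡ (R.trans (R.+-cong 1-homo (R.zeroʳ s)) (R.+-identityʳ _))))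
              (R.trans (R.+-identityˡ _) (R.*-identityʳ s)))

  open Algebra.Properties.Semiring.Sum semiring public

  sum-closed : ∀ E {n} {f : Fin n → Carrier} → (∀ i → f i ∈ ∣ E ∣) → sum f ∈ ∣ E ∣
  sum-closed E {ℕ.zero}  f∈ = Subfield.0∈ E
  sum-closed E {ℕ.suc n} f∈ = Subfield.+-closed E (f∈ zero) (sum-closed E (λ i → f∈ (suc i)))

  combination-closed : ∀ E {n} {a b : Fin n → Carrier} → (∀ i → a i ∈ ∣ E ∣) → (∀ i → b i ∈ ∣ E ∣) →
      combination a b ∈ ∣ E ∣
  combination-closed E a∈ b∈ = sum-closed E (λ i → Subfield.*-closed E (a∈ i) (b∈ i))

  ≋-root : ∀ {p rs} → p ≋ fromRoots rs → ∀ {r} → Any (r ≈_) rs → eval p r ≈ 0#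
  ≋-root {p} {rs} p≋ {r} r∈ = trans (eval-≋ {p} {fromRoots rs} p≋ r) (fromRoots-root r∈)

  -- Embeddings of L into the algebraic closure

  module Embeddings (K : Subfield) (closure : IsAlgebraicClosureOf K) (L : Subfield) (L/K : IsFiniteExtension L K) where
    open Closure K closure public
    open Self using (IsHom; restrict; evalAt-ext; hom-eval)

    K≤L : K ≤ L
    K≤L = proj₁ L/K

    record Extension (E : Subfield) (σ : Carrier → Carrier) : Set (Level.suc (c ⊔ ℓ₁)) where
      field
        field′ : Subfield
        map′   : Carrier → Carrier
        E≤     : E ≤ field′
        hom′   : IsHom field′ map′
        agrees : ∀ {a} → a ∈ ∣ E ∣ → map′ a ≈ σ a
    open Extension

    adjoin-one : ∀ x E → K ≤ E → ∀ {σ} → IsHom E σ → Σ[ X ∈ Extension E σ ] x ∈ ∣ field′ X ∣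
    adjoin-one x E K≤E {σ} h with minimal {E} K≤E x
    ... | f , f-minimal@(_ , ann , _) with conjugate-exists (proj₁ closure) h ann
    ...   | r , fr≈0 = record
            { field′ = adjoin E K≤E x
            ; map′   = extend E K≤E x Ωᴿ h f-minimal fr≈0
            ; E≤     = E≤adjoin E K≤E x
            ; hom′   = extend-isHom E K≤E x Ωᴿ h f-minimal fr≈0
            ; agrees = extend-agrees E K≤E x Ωᴿ h f-minimal fr≈0
            } , x∈adjoin E K≤E x

    adjoin-all : ∀ {n} (b : Fin n → Carrier) E → K ≤ E → ∀ {σ} → IsHom E σ →
                 Σ[ X ∈ Extension E σ ] (∀ i → b i ∈ ∣ field′ X ∣)
    adjoin-all {ℕ.zero}  b E K≤E h = record { E≤ = id ; hom′ = h ; agrees = λ _ → refl } , λ ()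
    adjoin-all {ℕ.suc n} b E K≤E h with adjoin-one (b zero) E K≤E h
    ... | X , b₀∈ with adjoin-all (b ∘ suc) (field′ X) (E≤ X ∘ K≤E) (hom′ X)
    ...   | Y , b∈ = record
            { E≤     = E≤ Y ∘ E≤ X
            ; hom′   = hom′ Y
            ; agrees = λ a∈ → trans (agrees Y (E≤ X a∈)) (agrees X a∈)
            } , λ { zero → E≤ Y b₀∈ ; (suc i) → b∈ i }

    lift-hom : ∀ E → K ≤ E → ∀ {σ} → IsHom E σ → ∃[ τ ] IsHom L τ × (∀ {a} → a ∈ ∣ E ∣ → τ a ≈ σ a)
    lift-hom E K≤E h =
      let n , b , basis = proj₂ L/K
          X , b∈ = adjoin-all b E K≤E h
          L≤X : L ≤ field′ X
          L≤X = λ x∈ → let a , a∈ , x≈ = IsBasis.spanning basis x∈ in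
            Subfield.resp (field′ X) (sym x≈) (combination-closed (field′ X) (λ i → E≤ X (K≤E (a∈ i))) b∈)
      in map′ X , restrict L≤X (hom′ X) , agrees X

    record IsEmbedding (E : Subfield) (σ : Carrier → Carrier) : Set (c ⊔ ℓ₁) where
      field
        isHom : IsHom L σ
        fixes : ∀ {a} → a ∈ ∣ E ∣ → σ a ≈ a
      open IsHom isHom public

    conjugate-embedding : ∀ {E} → K ≤ E → ∀ {x f r} → IsMinimalPolynomial E x f → eval f r ≈ 0# →
                          ∃[ σ ] IsEmbedding E σ × σ x ≈ r
    conjugate-embedding {E} K≤E {x} f-minimal fr≈0 =
      let h = extend-isHom E K≤E x Ωᴿ (id-hom E) f-minimal fr≈0
          τ , τ-hom , τ-agrees = lift-hom (adjoin E K≤E x) (E≤adjoin E K≤E x ∘ K≤E) h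
      in τ
       , record
         { isHom = τ-hom
         ; fixes = λ a∈ → trans (τ-agrees (E≤adjoin E K≤E x a∈)) (extend-agrees E K≤E x Ωᴿ (id-hom E) f-minimal fr≈0 a∈)
         }
       , trans (τ-agrees (x∈adjoin E K≤E x)) (extend-x E K≤E x Ωᴿ (id-hom E) f-minimal fr≈0)

    module _ {E σ} (E≤L : E ≤ L) (h : IsEmbedding E σ) where
      open IsEmbedding h

      embedding-eval : ∀ {p x} → All ∣ E ∣ p → x ∈ ∣ L ∣ → σ (eval p x) ≈ eval p (σ x)
      embedding-eval {p} {x} p∈ x∈ = trans (hom-eval isHom (All.map E≤L p∈) x∈) (evalAt-ext E fixes p∈ (σ x))

      embedding-root : ∀ {p x} → All ∣ E ∣ p → x ∈ ∣ L ∣ → eval p x ≈ 0# → eval p (σ x) ≈ 0#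
      embedding-root {p} {x} p∈ x∈ px≈0 = trans (sym (embedding-eval p∈ x∈))
        (trans (sym (cong (Subfield.0∈ L) (sym px≈0))) 0-homo)

    IsStable : Subfield → Subfield → Set (c ⊔ ℓ₁)
    IsStable F E = ∀ {σ} → IsEmbedding E σ → ∀ {x} → x ∈ ∣ F ∣ → σ x ∈ ∣ F ∣

    normal⇒stable : ∀ {E F} → E ≤ L → F ≤ L → IsNormal F E → IsStable F E
    normal⇒stable {E} {F} E≤L F≤L normal {σ} h {x} x∈ =
      let p , (_ , (p∈ , _ , px≈0) , _) , rs , rs∈ , p≋ = normal x∈
          σx-root = trans (sym (eval-≋ {p} {fromRoots rs} p≋ (σ x))) (embedding-root E≤L h p∈ (F≤L x∈) px≈0)
      in All.lookupₛ setoid (Subfield.resp F) rs∈ (root∈fromRoots rs σx-root)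

    -- Each root of the minimal polynomial of `x` is the image of `x` under some embedding over `E`,
    -- and stability keeps that image in `F`.
    stable⇒normal : ∀ {E F} → K ≤ E → F ≤ L → IsStable F E → IsNormal F E
    stable⇒normal {E} {F} K≤E F≤L stable {x} x∈ =
      let p , p-minimal = minimal {E} K≤E x
          rs , p≋ = roots {E} {x} {p} p-minimal
      in p , p-minimal , rs
       , All.tabulateₛ setoid (λ {r} r∈ →
           let σ , h , σx≈r = conjugate-embedding K≤E p-minimal (≋-root {p} {rs} p≋ r∈)
           in Subfield.resp F σx≈r (stable h x∈))
       , p≋

    -- All roots of the minimal polynomial are conjugates of `x`, hence equal to `x`; being
    -- distinct, there is only one. The polynomial is then X - x, and its constant coefficient puts
    -- `x` in `E`.
    fixed-separable⇒base : ∀ {E} → K ≤ E → ∀ {x} → (∀ {σ} → IsEmbedding E σ → σ x ≈ x) → SeparableElement E x →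
        x ∈ ∣ E ∣
    fixed-separable⇒base {E} K≤E {x} fixed (p , p-minimal@(_ , (p∈ , _ , px≈0) , _) , rs , unique , p≋) =
        go rs unique p≋ all≈x
      where
      all≈x : All (_≈ x) rs
      all≈x = All.tabulateₛ setoid λ {r} r∈ →
        let σ , h , σx≈r = conjugate-embedding K≤E p-minimal (≋-root {p} {rs} p≋ r∈)
        in trans (sym σx≈r) (fixed h)
      module E = Subfield E
      go : ∀ rs → Unique rs → p ≋ fromRoots rs → All (_≈ x) rs → x ∈ ∣ E ∣
      go [] _ p≋ _ = ⊥-elim (1≉0 (trans (sym (eval-fromRoots-[] x))
          (trans (sym (eval-≋ {p} {fromRoots []} p≋ x)) px≈0)))
      go (r ∷ []) _ p≋ (r≈x ∷ []) = E.resp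
        (trans (-‿cong (p≋ 0)) (trans (solve 1 (λ r → :- (:- r :* con (1 , 0) :+ con (0 , 0)) := r) refl r) r≈x))
        (E.-‿closed (coeff∈ E p∈ 0))
      go (r ∷ s ∷ rs) ((r≉s ∷ _) ∷ _) p≋ (r≈x ∷ s≈x ∷ _) = ⊥-elim (r≉s (trans r≈x (sym s≈x)))

    fixedByEmbeddings : Subfield
    fixedByEmbeddings = intermediateField (λ x → x ∈ ∣ L ∣ × (∀ {σ} → IsEmbedding K σ → σ x ≈ x))
      (λ x≈y (x∈ , fixed) → Subfield.resp L x≈y x∈ , λ h → trans
          (IsEmbedding.cong h (Subfield.resp L x≈y x∈) (sym x≈y)) (trans (fixed h) x≈y))
      (λ a∈ → K≤L a∈ , λ h → IsEmbedding.fixes h a∈)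
      (λ (x∈ , x-fixed) (y∈ , y-fixed) → Subfield.+-closed L x∈ y∈ ,
        λ h → trans (IsEmbedding.+-homo h x∈ y∈) (+-cong (x-fixed h) (y-fixed h)))
      (λ (x∈ , x-fixed) (y∈ , y-fixed) → Subfield.*-closed L x∈ y∈ ,
        λ h → trans (IsEmbedding.*-homo h x∈ y∈) (*-cong (x-fixed h) (y-fixed h)))

    fixedByEmbeddings-purelyInseparable : IsPurelyInseparable fixedByEmbeddings K
    fixedByEmbeddings-purelyInseparable (x∈ , fixed) = proj₂ closure _ , fixed-separable⇒base (λ x∈ → x∈) fixed

  open Algebra.Properties.Semiring.Mult semiring public using () renaming (_×_ to _·_)
  open DualNumbers Ωᴿ public using (dualNumbers)
  module 𝔻 = CommutativeRing dualNumbers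
  module Dual = Homomorphisms dualNumbers

  -- Derivatives and separability

  derivative : Polynomial → Polynomial
  derivative []      = []
  derivative (a ∷ p) = p ⊞ (0# ∷ derivative p)

  derivative-closed : ∀ E {p} → All ∣ E ∣ p → All ∣ E ∣ (derivative p)
  derivative-closed E []        = []
  derivative-closed E (a∈ ∷ p∈) = ⊞-closed E p∈ (Subfield.0∈ E ∷ derivative-closed E p∈)

  coeff-derivative : ∀ p i → coeff (derivative p) i ≈ ℕ.suc i · coeff p (ℕ.suc i)
  coeff-derivative []      i         = sym (·-0 (ℕ.suc i))
    where
    ·-0 : ∀ n → n · 0# ≈ 0#
    ·-0 ℕ.zero    = refl
    ·-0 (ℕ.suc n) = trans (+-identityˡ _) (·-0 n)
  coeff-derivative (a ∷ p) ℕ.zero    = coeff-⊞ p (0# ∷ derivative p) 0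
  coeff-derivative (a ∷ p) (ℕ.suc i) = trans (coeff-⊞ p (0# ∷ derivative p) (ℕ.suc i)) (+-congˡ (coeff-derivative p i))

  derivative-≋ : ∀ {p q} → p ≋ q → derivative p ≋ derivative q
  derivative-≋ {p} {q} p≋q i =
    trans (coeff-derivative p i) (trans (·-congʳ (ℕ.suc i) (p≋q (ℕ.suc i))) (sym (coeff-derivative q i)))
    where open Algebra.Properties.Semiring.Mult semiring using () renaming (×-congʳ to ·-congʳ)

  eval-derivative-∷ : ∀ a p x → eval (derivative (a ∷ p)) x ≈ eval p x + x * eval (derivative p) x
  eval-derivative-∷ a p x = trans (eval-⊞ p (0# ∷ derivative p) x) (+-congˡ (+-identityˡ _))

  constant : Carrier → 𝔻.Carrier
  constant a = a , 0#

  constant-hom : ∀ E → Dual.IsHom E constant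
  constant-hom E = record
    { cong   = λ _ x≈y → x≈y , refl
    ; +-homo = λ _ _ → refl , sym (+-identityˡ 0#)
    ; *-homo = λ {x} {y} _ _ → refl , solve 2 (λ x y → con (0 , 0) := x :* con (0 , 0) :+ con (0 , 0) :* y) refl x y
    ; 1-homo = refl , refl
    }

  -- Taylor's formula to first order, for coefficients which themselves
  -- move infinitesimally.
  evalAt-dual : ∀ {E σ} → (∀ {a} → a ∈ ∣ E ∣ → proj₁ (σ a) ≈ a) → ∀ {p} → All ∣ E ∣ p → ∀ x d →
                Dual.evalAt σ p (x , d) 𝔻.≈ (eval p x , proj₂ (Dual.evalAt σ p (x , 0#)) + d * eval (derivative p) x)
  evalAt-dual σ₁ [] x d = refl , sym (trans (+-identityˡ _) (zeroʳ d))
  evalAt-dual {E} {σ} σ₁ {a ∷ p} (a∈ ∷ p∈) x d =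
      +-cong (σ₁ a∈) (*-congˡ (proj₁ IH))
    , (begin
        proj₂ (σ a) + (x * proj₂ (Dual.evalAt σ p (x , d)) + d * proj₁ (Dual.evalAt σ p (x , d)))
          ≈⟨ +-congˡ (+-cong (*-congˡ (proj₂ IH)) (*-congˡ (proj₁ IH))) ⟩
        proj₂ (σ a) + (x * (w + d * v′) + d * v)
          ≈⟨ solve 7 (λ s x w d v v′ u → s :+ (x :* (w :+ d :* v′) :+ d :* v) := s :+
              (x :* w :+ con (0 , 0) :* u) :+ d :* (v :+ x :* v′))
               refl (proj₂ (σ a)) x w d v v′ (proj₁ (Dual.evalAt σ p (x , 0#))) ⟩
        proj₂ (σ a) + (x * w + 0# * proj₁ (Dual.evalAt σ p (x , 0#))) + d * (v + x * v′)
          ≈⟨ +-congˡ (*-congˡ (eval-derivative-∷ a p x)) ⟨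
        proj₂ (σ a) + (x * w + 0# * proj₁ (Dual.evalAt σ p (x , 0#))) + d * eval (derivative (a ∷ p)) x ∎)
    where
    open ≈-Reasoning
    IH = evalAt-dual {E} {σ} σ₁ p∈ x d
    v = eval p x
    v′ = eval (derivative p) x
    w = proj₂ (Dual.evalAt σ p (x , 0#))

  evalAt-constant : ∀ p x d → Dual.evalAt constant p (x , d) 𝔻.≈ (eval p x , d * eval (derivative p) x)
  evalAt-constant p x d =
    let v , w = evalAt-dual {everything} {constant} (λ _ → refl) (everything∋ p) x d
    in v , trans w (trans (+-congʳ (constant₂ p)) (+-identityˡ _))
    where
    constant₂ : ∀ p → proj₂ (Dual.evalAt constant p (x , 0#)) ≈ 0#
    constant₂ []      = refl
    constant₂ (a ∷ p) = trans (+-identityˡ _)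
        (trans (+-cong (trans (*-congˡ (constant₂ p)) (zeroʳ x)) (zeroˡ _)) (+-identityˡ 0#))

  -- The Leibniz rule is the ε-part of the multiplicativity of evaluation at x + ε.
  eval-derivative-⊠ : ∀ p q x → eval (derivative (p ⊠ q)) x ≈ eval p x * eval (derivative q) x + eval
      (derivative p) x * eval q x
  eval-derivative-⊠ p q x = begin
    eval (derivative (p ⊠ q)) x             ≈⟨ trans (proj₂ (evalAt-constant (p ⊠ q) x 1#)) (*-identityˡ _) ⟨
    proj₂ (Dual.evalAt constant (p ⊠ q) (x , 1#)) ≈⟨ proj₂
        (Dual.evalAt-⊠ (constant-hom everything) (everything∋ p) (everything∋ q) (x , 1#)) ⟩
    proj₁ (Dual.evalAt constant p (x , 1#)) * proj₂ (Dual.evalAt constant q (x , 1#)) + proj₂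
        (Dual.evalAt constant p (x , 1#)) * proj₁ (Dual.evalAt constant q (x , 1#))
      ≈⟨ +-cong (*-cong (proj₁ (evalAt-constant p x 1#)) (trans (proj₂ (evalAt-constant q x 1#)) (*-identityˡ _)))
                (*-cong (trans (proj₂ (evalAt-constant p x 1#)) (*-identityˡ _)) (proj₁ (evalAt-constant q x 1#))) ⟩
    eval p x * eval (derivative q) x + eval (derivative p) x * eval q x ∎
    where open ≈-Reasoning

  eval-derivative-fromRoots-∷ : ∀ r rs x → eval (derivative (fromRoots (r ∷ rs))) x ≈
                                (x - r) * eval (derivative (fromRoots rs)) x + eval (fromRoots rs) x
  eval-derivative-fromRoots-∷ r rs x = trans (eval-derivative-⊠ (linear r) (fromRoots rs) x)
    (+-cong (*-congʳ (eval-linear r x)) (trans (*-congʳ linear′) (*-identityˡ _)))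
    where
    linear′ : eval (derivative (linear r)) x ≈ 1#
    linear′ = solve 1 (λ x → con (1 , 0) :+ con (0 , 0) :+ x :* (con (0 , 0) :+ x :* con (0 , 0)) := con (1 , 0)) refl x

  -- At the head root the derivative equals the value of the product of the remaining factors, which
  -- is nonzero by distinctness; at a later root it is the derivative of that product times the
  -- nonzero x - r.
  unique⇒simple : ∀ rs → Unique rs → ∀ {x} → Any (x ≈_) rs → ¬ eval (derivative (fromRoots rs)) x ≈ 0#
  unique⇒simple (r ∷ rs) (r∉rs ∷ _) {x} (here x≈r) p′x≈0 =
      All.lookupₛ setoid (λ u≈v r≉u r≈v → r≉u (trans r≈v (sym u≈v)))
    r∉rs (root∈fromRoots rs (begin
      eval (fromRoots rs) x                   ≈⟨ +-identityˡ _ ⟨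
      0# + eval (fromRoots rs) x              ≈⟨ +-congʳ (trans (*-congʳ (x≈y⇒x-y≈0 x≈r)) (zeroˡ _)) ⟨
      (x - r) * eval (derivative (fromRoots rs)) x + eval (fromRoots rs) x ≈⟨ eval-derivative-fromRoots-∷ r rs x ⟨
      eval (derivative (fromRoots (r ∷ rs))) x ≈⟨ p′x≈0 ⟩
      0#                                      ∎)) (sym x≈r)
    where open ≈-Reasoning
  unique⇒simple (r ∷ rs) (r∉rs ∷ unique) {x} (there x∈) p′x≈0 = unique⇒simple rs unique x∈
    (*-cancelˡ-nonZero
      (λ x-r≈0 → All.lookupₛ setoid (λ u≈v r≉u r≈v → r≉u (trans r≈v (sym u≈v))) r∉rs x∈ (sym (x-y≈0⇒x≈y x r x-r≈0)))
      (begin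
        (x - r) * eval (derivative (fromRoots rs)) x ≈⟨ trans (+-congˡ (fromRoots-root x∈)) (+-identityʳ _) ⟨
        (x - r) * eval (derivative (fromRoots rs)) x + eval (fromRoots rs) x ≈⟨ eval-derivative-fromRoots-∷ r rs x ⟨
        eval (derivative (fromRoots (r ∷ rs))) x ≈⟨ p′x≈0 ⟩
        0# ∎))
    where open ≈-Reasoning

  simple⇒unique : ∀ rs → (∀ {x} → Any (x ≈_) rs → ¬ eval (derivative (fromRoots rs)) x ≈ 0#) → Unique rs
  simple⇒unique []       simple = []
  simple⇒unique (r ∷ rs) simple =
      All.tabulateₛ setoid (λ {s} s∈ r≈s → simple {r} (here refl) (trans (eval-derivative-fromRoots-∷ r rs r)
        (trans (+-cong (trans (*-congʳ (-‿inverseʳ r)) (zeroˡ _)) (fromRoots-root (Any.map (trans r≈s) s∈)))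
            (+-identityʳ 0#))))
    ∷ simple⇒unique rs (λ {s} s∈ q′s≈0 → simple (there s∈) (trans (eval-derivative-fromRoots-∷ r rs s)
        (trans (+-cong (trans (*-congˡ q′s≈0) (zeroʳ _)) (fromRoots-root s∈)) (+-identityʳ 0#))))

  -- A form of separability in which `g` need not be minimal. It passes to larger base fields with
  -- the same `g`, whereas the minimal polynomial changes with the base.
  IsSimpleRootOver : Subfield → Carrier → Set (c ⊔ ℓ₁)
  IsSimpleRootOver E x = ∃[ g ] All ∣ E ∣ g × eval g x ≈ 0# × ¬ eval (derivative g) x ≈ 0#

  simpleRoot-mono : ∀ {E F x} → E ≤ F → IsSimpleRootOver E x → IsSimpleRootOver F x
  simpleRoot-mono E≤F (g , g∈ , rest) = g , All.map E≤F g∈ , rest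

  separable⇒simpleRoot : ∀ {E x} → SeparableElement E x → IsSimpleRootOver E x
  separable⇒simpleRoot {E} {x} (p , (_ , (p∈ , _ , px≈0) , _) , rs , unique , p≋) = p , p∈ , px≈0 , λ p′x≈0 →
    unique⇒simple rs unique (root∈fromRoots rs (trans (sym (eval-≋ {p} {fromRoots rs} p≋ x)) px≈0))
      (trans (sym (eval-≋ {derivative p} {derivative (fromRoots rs)} (derivative-≋ {p} {fromRoots rs} p≋) x)) p′x≈0)

  -- If `m` and its derivative both vanished at `x`, then x + ε would be a root of `m` in the dual
  -- numbers, hence a root of `g`, and its ε-part would say that the derivative of `g` vanishes at
  -- `x`.
  minimal-simple : ∀ {E x m} → IsSimpleRootOver E x → IsMinimalPolynomial E x m → ¬ eval (derivative m) x ≈ 0#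
  minimal-simple {E} {x} {m} (g , g∈ , gx≈0 , g′x≉0) m-minimal@(_ , (_ , _ , mx≈0) , _) m′x≈0 = g′x≉0
    (trans (sym (trans (proj₂ (evalAt-constant g x 1#)) (*-identityˡ _)))
      (proj₂ (relation-transfers dualNumbers (constant-hom E) {x} m-minimal m-vanishes g∈ gx≈0)))
    where
    m-vanishes : Dual.evalAt constant m (x , 1#) 𝔻.≈ 𝔻.0#
    m-vanishes = trans (proj₁ (evalAt-constant m x 1#)) mx≈0 , trans (proj₂ (evalAt-constant m x 1#))
        (trans (*-congˡ m′x≈0) (zeroʳ 1#))

  -- Separability of simple extensions

  module Separability (K : Subfield) (closure : IsAlgebraicClosureOf K) where
    open Closure K closure

    simpleRoot⇒separable : ∀ {E} → K ≤ E → ∀ {x} → IsSimpleRootOver E x → SeparableElement E x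
    simpleRoot⇒separable {E} K≤E {x} simple with minimal {E} K≤E x
    ... | m , m-minimal@(_ , (m∈ , _ , _) , _) = m , m-minimal , rs , simple⇒unique rs rs-simple , m≋
      where
      rs = proj₁ (roots {E} {x} {m} m-minimal)
      m≋ : m ≋ fromRoots rs
      m≋ = proj₂ (roots {E} {x} {m} m-minimal)
      m′∈ = derivative-closed E m∈
      -- Only the root `x` is known to be simple. The homomorphism of E(x) with x ↦ r is injective
      -- and carries m′(x) to m′(r), so simplicity passes to every root.
      rs-simple : ∀ {r} → Any (r ≈_) rs → ¬ eval (derivative (fromRoots rs)) r ≈ 0#
      rs-simple {r} r∈ p′r≈0 = minimal-simple {E} simple m-minimal
        (hom-reflects-0 (extend-isHom E K≤E x Ωᴿ (id-hom E) m-minimal mr≈0) (derivative m , m′∈ , refl)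
          (trans (extend-eval E K≤E x Ωᴿ (id-hom E) m-minimal mr≈0 m′∈ refl)
            (trans (eval-≋ {derivative m} {derivative (fromRoots rs)} (derivative-≋ {m} {fromRoots rs} m≋) r) p′r≈0)))
        where
        mr≈0 : eval m r ≈ 0#
        mr≈0 = ≋-root {m} {rs} m≋ r∈

    -- If y were inseparable, there would be a derivation of E(y) over E with
    -- y ↦ 1.  As x is a simple root over E(y), it extends to E(y)(x), where it
    -- has to kill x, hence also y = u(x).
    module _ {E} (K≤E : K ≤ E) {x} (x-simple : IsSimpleRootOver E x) {y} (y∈ : y ∈ ∣ adjoin E K≤E x ∣)
             {h} (h-minimal : IsMinimalPolynomial E y h) (h′y≈0 : eval (derivative h) y ≈ 0#) where
      private
        E₁ = adjoin E K≤E y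
        E≤E₁ = E≤adjoin E K≤E y

        h-vanishes : Dual.evalAt constant h (y , 1#) 𝔻.≈ 𝔻.0#
        h-vanishes = trans (proj₁ (evalAt-constant h y 1#)) (proj₂ (proj₂ (proj₁ (proj₂ h-minimal))))
                   , trans (proj₂ (evalAt-constant h y 1#)) (trans (*-congˡ h′y≈0) (zeroʳ 1#))

        D₁ : Carrier → 𝔻.Carrier
        D₁ = extend E K≤E y dualNumbers (constant-hom E) h-minimal h-vanishes

        D₁-hom : Dual.IsHom E₁ D₁
        D₁-hom = extend-isHom E K≤E y dualNumbers (constant-hom E) h-minimal h-vanishes

        D₁-section : ∀ {z} → z ∈ ∣ E₁ ∣ → proj₁ (D₁ z) ≈ z
        D₁-section (p , p∈ , py≈z) = trans (proj₁
            (extend-eval E K≤E y dualNumbers (constant-hom E) h-minimal h-vanishes p∈ py≈z))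
          (trans (proj₁ (evalAt-constant p y 1#)) py≈z)

        K≤E₁ : K ≤ E₁
        K≤E₁ a∈ = E≤E₁ (K≤E a∈)

      contradictory : ∀ {m} → IsMinimalPolynomial E₁ x m → ⊥
      contradictory {m} m-minimal@(_ , (m∈ , _ , mx≈0) , _) = 1≉0 (begin
          1#                              ≈⟨ proj₂
              (extend-x E K≤E y dualNumbers (constant-hom E) h-minimal h-vanishes) ⟨
          proj₂ (D₁ y)                    ≈⟨ proj₂ (D₂-agrees (x∈adjoin E K≤E y)) ⟨
          proj₂ (D₂ y)                    ≈⟨ proj₂ (D₂-eval (proj₁ (proj₂ y∈)) (proj₂ (proj₂ y∈))) ⟩
          d * eval (derivative (proj₁ y∈)) x ≈⟨ *-congʳ d≈0 ⟩
          0# * eval (derivative (proj₁ y∈)) x ≈⟨ zeroˡ _ ⟩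
          0#                              ∎)
        where
        open ≈-Reasoning
        m′x⁻¹ = invert (minimal-simple {E₁} (simpleRoot-mono {E} {E₁} E≤E₁ x-simple) m-minimal)
        w = proj₂ (Dual.evalAt D₁ m (x , 0#))
        -- By Taylor's formula the ε-part of `m` at x + d ε, with its coefficients moved by `D₁`, is
        -- w + d m′(x); this `d` solves for zero.
        d = - w * proj₁ m′x⁻¹

        m-vanishes : Dual.evalAt D₁ m (x , d) 𝔻.≈ 𝔻.0#
        m-vanishes = trans (proj₁ (evalAt-dual {E₁} D₁-section m∈ x d)) mx≈0 , trans
            (proj₂ (evalAt-dual {E₁} D₁-section m∈ x d)) (begin
          w + - w * proj₁ m′x⁻¹ * eval (derivative m) x
            ≈⟨ solve 3 (λ w i v → w :+ (:- w) :* i :* v := w :- w :* (v :* i)) refl w (proj₁ m′x⁻¹)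
                (eval (derivative m) x) ⟩
          w - w * (eval (derivative m) x * proj₁ m′x⁻¹) ≈⟨ +-congˡ
              (-‿cong (trans (*-congˡ (proj₂ m′x⁻¹)) (*-identityʳ w))) ⟩
          w - w ≈⟨ -‿inverseʳ w ⟩
          0# ∎)

        D₂ : Carrier → 𝔻.Carrier
        D₂ = extend E₁ K≤E₁ x dualNumbers D₁-hom m-minimal m-vanishes

        D₂-agrees : ∀ {z} → z ∈ ∣ E₁ ∣ → D₂ z 𝔻.≈ D₁ z
        D₂-agrees = extend-agrees E₁ K≤E₁ x dualNumbers D₁-hom m-minimal m-vanishes

        D₂-eval : ∀ {p z} → All ∣ E ∣ p → eval p x ≈ z → D₂ z 𝔻.≈ (z , d * eval (derivative p) x)
        D₂-eval {p} {z} p∈ px≈z = 𝔻.trans (extend-eval E₁ K≤E₁ x dualNumbers D₁-hom m-minimal m-vanishes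
            (All.map E≤E₁ p∈) px≈z)
          (𝔻.trans (Dual.evalAt-ext E D₁-constant p∈ (x , d))
            (trans (proj₁ (evalAt-constant p x d)) px≈z , proj₂ (evalAt-constant p x d)))
          where
          D₁-constant : ∀ {a} → a ∈ ∣ E ∣ → D₁ a 𝔻.≈ constant a
          D₁-constant = extend-agrees E K≤E y dualNumbers (constant-hom E) h-minimal h-vanishes

        -- The polynomial g witnessing that `x` is simple has coefficients in `E`, on which the
        -- derivation is zero, so applying it to g(x) = 0 gives d g′(x) = 0.
        d≈0 : d ≈ 0#
        d≈0 = [ id , (λ g′x≈0 → ⊥-elim (proj₂ (proj₂ (proj₂ x-simple)) g′x≈0)) ]′
            (integral {d} {eval (derivative (proj₁ x-simple)) x}
          (trans (sym (proj₂ (D₂-eval (proj₁ (proj₂ x-simple)) (proj₁ (proj₂ (proj₂ x-simple))))))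
            (proj₂ (Dual.IsHom.0-homo (extend-isHom E₁ K≤E₁ x dualNumbers D₁-hom m-minimal m-vanishes)))))

    adjoin-separable : ∀ {E} (K≤E : K ≤ E) {x} → IsSimpleRootOver E x → IsSeparable (adjoin E K≤E x) E
    adjoin-separable {E} K≤E {x} simple {y} y∈ = simpleRoot⇒separable {E} K≤E
      (let h , h-minimal@(_ , (h∈ , _ , hy≈0) , _) = minimal {E} K≤E y in
       h , h∈ , hy≈0 , λ h′y≈0 →
         contradictory {E} K≤E simple y∈ h-minimal h′y≈0
           (proj₂ (minimal {adjoin E K≤E y} (λ a∈ → E≤adjoin E K≤E y (K≤E a∈)) x)))

  open Algebra.Properties.Semiring.Exp semiring public using (_^_; ^-congˡ)
  open Algebra.Properties.Semiring.Mult semiring using (×-congʳ; ×-congˡ; ×-homo-+; ×1-homo-*; ×-assoc-*; ×-homo-1)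

  -- Positive characteristic

  ·≈*1 : ∀ n x → n · x ≈ (n · 1#) * x
  ·≈*1 n x = sym (trans (×-assoc-* n 1# x) (×-congʳ n (*-identityˡ x)))

  -- Leastness does the work of primality: it makes k! nonzero for k < p, and division with
  -- remainder makes `p` divide every n with n · 1 = 0.
  record IsCharacteristic (p : ℕ) : Set ℓ₁ where
    field
      p·1≈0 : p · 1# ≈ 0#
      least : ∀ {k} → 0 ℕ.< k → k ℕ.< p → ¬ k · 1# ≈ 0#

    p≢1 : ¬ p ≡ 1
    p≢1 ≡.refl = 1≉0 (trans (sym (×-homo-1 1#)) p·1≈0)

    multiple : .{{_ : ℕ.NonZero p}} → ∀ n → n · 1# ≈ 0# → p ∣ₙ n
    multiple n n·1≈0 with n % p in n%p≡r
    ... | ℕ.zero  = m%n≡0⇒n∣m n p n%p≡r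
    ... | ℕ.suc r = ⊥-elim (least (s≤s z≤n) (≡.subst (ℕ._< p) n%p≡r (m%n<n n p)) (begin
      ℕ.suc r · 1#                         ≈⟨ +-identityʳ _ ⟨
      ℕ.suc r · 1# + 0#                    ≈⟨ +-congˡ (trans (×1-homo-* (n / p) p) (trans (*-congˡ p·1≈0) (zeroʳ _))) ⟨
      ℕ.suc r · 1# + (n / p ℕ.* p) · 1#    ≈⟨ ×-homo-+ 1# (ℕ.suc r) (n / p ℕ.* p) ⟨
      (ℕ.suc r ℕ.+ n / p ℕ.* p) · 1#       ≡⟨ ≡.cong (λ r → (r ℕ.+ n / p ℕ.* p) · 1#) n%p≡r ⟨
      (n % p ℕ.+ n / p ℕ.* p) · 1#         ≡⟨ ≡.cong (_· 1#) (m≡m%n+[m/n]*n n p) ⟨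
      n · 1#                               ≈⟨ n·1≈0 ⟩
      0#                                   ∎))
      where open ≈-Reasoning

    factorial-nonZero : ∀ k → k ℕ.< p → ¬ (k !) · 1# ≈ 0#
    factorial-nonZero ℕ.zero    k<p k!≈0 = 1≉0 (trans (sym (×-homo-1 1#)) k!≈0)
    factorial-nonZero (ℕ.suc k) k<p k!≈0 = factorial-nonZero k (ℕₚ.<⇒≤ k<p)
      (*-cancelˡ-nonZero (least (s≤s z≤n) k<p) (trans (sym (×1-homo-* (ℕ.suc k) (k !))) k!≈0))

    factorial≈0 : .{{_ : ℕ.NonZero p}} → (p !) · 1# ≈ 0#
    factorial≈0 = ≡.subst (λ n → (n !) · 1# ≈ 0#) (ℕₚ.suc-pred p)
      (trans (×1-homo-* (ℕ.suc (ℕ.pred p)) (ℕ.pred p !))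
        (trans (*-congʳ (trans (reflexive (≡.cong (_· 1#) (ℕₚ.suc-pred p))) p·1≈0)) (zeroˡ _)))

    -- The product of the binomial coefficient with k! (p - k)! is p!, which vanishes, while both
    -- factorials of smaller numbers do not.
    choose≈0 : .{{_ : ℕ.NonZero p}} → ∀ {k} → 0 ℕ.< k → k ℕ.< p → (p C k) · 1# ≈ 0#
    choose≈0 {k} 0<k k<p = *-cancelˡ-nonZero
      (λ d≈0 → factorial-nonZero (p ℕ.∸ k) (ℕₚ.∸-monoʳ-< 0<k (ℕₚ.<⇒≤ k<p))
        (*-cancelˡ-nonZero (factorial-nonZero k k<p) (trans (sym (×1-homo-* (k !) ((p ℕ.∸ k) !))) d≈0)))
      (begin
        (k ! ℕ.* (p ℕ.∸ k) !) · 1# * (p C k) · 1# ≈⟨ *-comm _ _ ⟩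
        (p C k) · 1# * (k ! ℕ.* (p ℕ.∸ k) !) · 1# ≈⟨ ×1-homo-* (p C k) (k ! ℕ.* (p ℕ.∸ k) !) ⟨
        ((p C k) ℕ.* (k ! ℕ.* (p ℕ.∸ k) !)) · 1#  ≡⟨ ≡.cong (_· 1#) (≡.trans
          (≡.cong (ℕ._* (k ! ℕ.* (p ℕ.∸ k) !)) (nCk≡n!/k![n-k]! (ℕₚ.<⇒≤ k<p)))
          (m/n*n≡m {{k !* (p ℕ.∸ k) !≢0}} (k![n∸k]!∣n! (ℕₚ.<⇒≤ k<p)))) ⟩
        (p !) · 1#                               ≈⟨ factorial≈0 ⟩
        0#                                       ∎)
      where open ≈-Reasoning

  open IsCharacteristic

  frobenius-+ : ∀ {p} → IsCharacteristic (ℕ.suc p) → ∀ x y → (x + y) ^ ℕ.suc p ≈ x ^ ℕ.suc p + y ^ ℕ.suc p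
  frobenius-+ {p} char x y = begin
    (x + y) ^ ℕ.suc p                  ≈⟨ Binomial.theorem (ℕ.suc p) x y ⟩
    term zero + sum (term ∘ suc)       ≈⟨ +-congˡ (sum-init-last (term ∘ suc)) ⟩
    term zero + (sum middle + term (fromℕ (ℕ.suc p)))
      ≈⟨ +-cong first (+-cong (trans (sum-cong-≋ middle≈0) (sum-replicate-zero p)) last) ⟩
    y ^ ℕ.suc p + (0# + x ^ ℕ.suc p)   ≈⟨ solve 2 (λ u v → v :+ (con (0 , 0) :+ u) := u :+ v) refl (x ^ ℕ.suc p)
        (y ^ ℕ.suc p) ⟩
    x ^ ℕ.suc p + y ^ ℕ.suc p          ∎
    where
    open ≈-Reasoning
    module Binomial = Algebra.Properties.CommutativeSemiring.Binomial commutativeSemiring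
    term = Binomial.binomialTerm x y (ℕ.suc p)
    middle : Fin p → Carrier
    middle i = term (suc (inject₁ i))
    first : term zero ≈ y ^ ℕ.suc p
    first = trans (×-homo-1 _) (*-identityˡ _)
    last : term (fromℕ (ℕ.suc p)) ≈ x ^ ℕ.suc p
    last rewrite toℕ-fromℕ p | nCn≡1 (ℕ.suc p) | ℕₚ.n∸n≡0 p = trans (×-homo-1 _) (*-identityʳ _)
    middle≈0 : ∀ i → middle i ≈ 0#
    middle≈0 i = trans (·≈*1 (ℕ.suc p C toℕ (suc (inject₁ i))) _) (trans (*-congʳ (choose≈0 char (s≤s z≤n)
      (s≤s (≡.subst (ℕ._< p) (≡.sym (toℕ-inject₁ i)) (toℕ<n i))))) (zeroˡ _))

  ^≈0⇒≈0 : ∀ n {x} → x ^ n ≈ 0# → x ≈ 0#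
  ^≈0⇒≈0 ℕ.zero    1≈0 = ⊥-elim (1≉0 1≈0)
  ^≈0⇒≈0 (ℕ.suc n) xxⁿ≈0 = [ id , ^≈0⇒≈0 n ]′ (integral xxⁿ≈0)

  -- Additivity is applied to y = x + (y - x); this gives the p-th power of y - x without computing
  -- that of - x.
  frobenius-injective : ∀ {p} → IsCharacteristic (ℕ.suc p) → ∀ {x y} → y ^ ℕ.suc p ≈ x ^ ℕ.suc p → y ≈ x
  frobenius-injective {p} char {x} {y} yᵖ≈xᵖ = x-y≈0⇒x≈y y x (^≈0⇒≈0 (ℕ.suc p) (begin
    (y - x) ^ ℕ.suc p               ≈⟨ solve 2 (λ a b → a := (b :+ a) :- b) refl _ (x ^ ℕ.suc p) ⟩
    x ^ ℕ.suc p + (y - x) ^ ℕ.suc p - x ^ ℕ.suc p ≈⟨ +-congʳ (frobenius-+ char x (y - x)) ⟨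
    (x + (y - x)) ^ ℕ.suc p - x ^ ℕ.suc p ≈⟨ +-congʳ
        (^-congˡ (ℕ.suc p) (solve 2 (λ x y → x :+ (y :- x) := y) refl x y)) ⟩
    y ^ ℕ.suc p - x ^ ℕ.suc p       ≈⟨ x≈y⇒x-y≈0 yᵖ≈xᵖ ⟩
    0#                              ∎))
    where open ≈-Reasoning

  characteristic : ∀ n → ℕ.suc n · 1# ≈ 0# → ∃[ p ] IsCharacteristic (ℕ.suc p)
  characteristic = <-rec _ λ n rec n·1≈0 → choose n rec n·1≈0 em
    where
    choose : ∀ n → (∀ {m} → m ℕ.< n → ℕ.suc m · 1# ≈ 0# → ∃[ p ] IsCharacteristic (ℕ.suc p)) → ℕ.suc n · 1# ≈ 0# →
             Dec (∃[ m ] m ℕ.< n × ℕ.suc m · 1# ≈ 0#) → ∃[ p ] IsCharacteristic (ℕ.suc p)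
    choose n rec n·1≈0 (yes (m , m<n , m·1≈0)) = rec m<n m·1≈0
    choose n rec n·1≈0 (no none) = n , record
      { p·1≈0 = n·1≈0
      ; least = λ { {ℕ.suc k} _ (s≤s k<n) k·1≈0 → none (k , k<n , k·1≈0) }
      }

  coeff-drop : ∀ k q i → coeff (drop k q) i ≡ coeff q (k ℕ.+ i)
  coeff-drop ℕ.zero    q       i = ≡.refl
  coeff-drop (ℕ.suc k) []      i = ≡.refl
  coeff-drop (ℕ.suc k) (a ∷ q) i = coeff-drop k q i

  eval-drop : ∀ k q x → (∀ {i} → i ℕ.< k → coeff q i ≈ 0#) → eval q x ≈ x ^ k * eval (drop k q) x
  eval-drop ℕ.zero    q       x q≈0 = sym (*-identityˡ _)
  eval-drop (ℕ.suc k) []      x q≈0 = sym (zeroʳ _)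
  eval-drop (ℕ.suc k) (a ∷ q) x q≈0 = trans (+-cong (q≈0 (s≤s z≤n)) (*-congˡ (eval-drop k q x (λ i<k → q≈0 (s≤s i<k)))))
    (trans (+-identityˡ _) (sym (*-assoc x _ _)))

  -- This finds g with q(X) = g(X^(p+1)); the characteristic is `suc p`, so after a kept coefficient
  -- the next `p` are zero and are dropped. The bound `k` on the length drives the recursion, as
  -- `drop p q` is not a subterm.
  deflate : ∀ E p x k q → length q ℕ.≤ k → All ∣ E ∣ q → (∀ i → ¬ ℕ.suc p ∣ₙ i → coeff q i ≈ 0#) →
            ∃[ g ] All ∣ E ∣ g × (∀ j → coeff g j ≈ coeff q (j ℕ.* ℕ.suc p)) × eval g (x ^ ℕ.suc p) ≈ eval q x
  deflate E p x k []      _         _         _      = [] , [] , (λ _ → refl) , refl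
  deflate E p x (ℕ.suc k) (a ∷ q) (s≤s |q|≤k) (a∈ ∷ q∈) sparse =
    let g , g∈ , g-coeff , g-eval = deflate E p x k (drop p q)
          (ℕₚ.≤-trans (≡.subst (ℕ._≤ length q) (≡.sym (length-drop p q)) (ℕₚ.m∸n≤m (length q) p)) |q|≤k)
          (drop⁺ p q∈)
          (λ i p∤i → trans (reflexive (coeff-drop p q i))
              (sparse (ℕ.suc p ℕ.+ i) (λ p∣p+i → p∤i (∣m+n∣m⇒∣n p∣p+i ∣-refl))))
    in a ∷ g , a∈ ∷ g∈
     , (λ { ℕ.zero → refl ; (ℕ.suc j) → trans (g-coeff j) (reflexive (coeff-drop p q (j ℕ.* ℕ.suc p))) })
     , +-congˡ (trans (*-congˡ g-eval) (trans (*-assoc x _ _)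
         (*-congˡ (sym (eval-drop p q x (λ {i} i<p → sparse (ℕ.suc i) (>⇒∤′ i<p)))))))
    where
    >⇒∤′ : ∀ {i} → i ℕ.< p → ¬ ℕ.suc p ∣ₙ ℕ.suc i
    >⇒∤′ i<p = >⇒∤ (s≤s i<p)

  -- Inseparable elements and Frobenius descent

  module Inseparability (K : Subfield) (closure : IsAlgebraicClosureOf K) where
    open Closure K closure

    -- The minimal polynomial of an inseparable element has zero derivative, so
    -- it is a polynomial in X ^ p.
    p-th-power-degree : ∀ {x n f} → ¬ IsSimpleRootOver K x → IsMonicAnnihilator K x n f →
                        (∀ m q → IsMonicAnnihilator K x m q → n ℕ.≤ m) →
                        ∃[ p ] IsCharacteristic (ℕ.suc p) × ∃[ k ] k ℕ.< n × ∃[ g ] IsMonicAnnihilator K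
                            (x ^ ℕ.suc p) k g
    p-th-power-degree {n = ℕ.zero} {f} _ (_ , f-monic , fx≈0) _ = ⊥-elim (monic-degree0-nonzero {f} f-monic fx≈0)
    p-th-power-degree {x} {ℕ.suc n} {f} inseparable (f∈ , (monic , above) , fx≈0) minimal =
      p , char , degree p char (multiple char (ℕ.suc n) (n·1≈0))
      where
      f′≋[] : derivative f ≋ []
      f′≋[] = below-minimal {K} {x} minimal (ℕ.suc n) ℕₚ.≤-refl (derivative-closed K f∈)
        (λ i n<i → trans (coeff-derivative f i)
            (trans (×-congʳ (ℕ.suc i) (above (ℕ.suc i) (s≤s n<i))) (trans (·≈*1 (ℕ.suc i) 0#) (zeroʳ _))))
        (classical λ f′x≉0 → inseparable (f , f∈ , fx≈0 , f′x≉0))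
      i·1*fᵢ≈0 : ∀ i → (ℕ.suc i · 1#) * coeff f (ℕ.suc i) ≈ 0#
      i·1*fᵢ≈0 i = trans (sym (·≈*1 (ℕ.suc i) _)) (trans (sym (coeff-derivative f i)) (f′≋[] i))
      -- The leading coefficient of `f` is 1, so its contribution to the vanishing derivative is the
      -- degree itself: the characteristic is positive and divides the degree.
      n·1≈0 : ℕ.suc n · 1# ≈ 0#
      n·1≈0 = trans (sym (*-identityʳ _)) (trans (*-congˡ (sym monic)) (i·1*fᵢ≈0 n))
      p = proj₁ (characteristic n n·1≈0)
      char = proj₂ (characteristic n n·1≈0)
      degree : ∀ p → IsCharacteristic (ℕ.suc p) → ℕ.suc p ∣ₙ ℕ.suc n →
               ∃[ k ] k ℕ.< ℕ.suc n × ∃[ g ] IsMonicAnnihilator K (x ^ ℕ.suc p) k g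
      degree ℕ.zero    char _ = ⊥-elim (p≢1 char ≡.refl)
      degree p@(ℕ.suc p′) char (divides k@(ℕ.suc _) n≡k*p) =
        let g , g∈ , g-coeff , g-eval = deflate K p x (length f) f ℕₚ.≤-refl f∈ sparse
        in k , ≡.subst (k ℕ.<_) (≡.sym n≡k*p) (ℕₚ.m<m*n k (ℕ.suc p) (s≤s (s≤s z≤n)))
         , g , g∈
         , ( trans (g-coeff k) (trans (reflexive (≡.cong (coeff f) (≡.sym n≡k*p))) monic)
           , λ j k<j → trans (g-coeff j) (above _
                 (≡.subst (ℕ._< j ℕ.* ℕ.suc p) (≡.sym n≡k*p) (ℕₚ.*-monoˡ-< (ℕ.suc p) k<j))))
         , trans g-eval fx≈0
        where
        sparse : ∀ i → ¬ ℕ.suc p ∣ₙ i → coeff f i ≈ 0#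
        sparse ℕ.zero    p∤i = ⊥-elim (p∤i (divides 0 ≡.refl))
        sparse (ℕ.suc i) p∤i = *-cancelˡ-nonZero (λ i·1≈0 → p∤i (multiple char (ℕ.suc i) i·1≈0)) (i·1*fᵢ≈0 i)

    module _ {E L σ} (K≤E : K ≤ E) (E≤L : E ≤ L) (h : Self.IsHom L σ)
             (fixes-separable : ∀ {x} → x ∈ ∣ E ∣ → IsSimpleRootOver K x → σ x ≈ x) where
      open Self.IsHom h

      private
        ^-closed : ∀ F n {x} → x ∈ ∣ F ∣ → x ^ n ∈ ∣ F ∣
        ^-closed F ℕ.zero    x∈ = Subfield.1∈ F
        ^-closed F (ℕ.suc n) x∈ = Subfield.*-closed F x∈ (^-closed F n x∈)

        ^-homo : ∀ n {x} → x ∈ ∣ L ∣ → σ (x ^ n) ≈ σ x ^ n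
        ^-homo ℕ.zero    x∈ = 1-homo
        ^-homo (ℕ.suc n) x∈ = trans (*-homo x∈ (^-closed L n x∈)) (*-congˡ (^-homo n x∈))

        -- The degree is that of any annihilator rather than of the minimal polynomial, so the
        -- induction hypothesis accepts the polynomial that `p-th-power-degree` finds for the p-th
        -- power as it stands.
        Fixed : ℕ → Set (c ⊔ ℓ₁)
        Fixed n = ∀ {x f} → x ∈ ∣ E ∣ → IsMonicAnnihilator K x n f → σ x ≈ x

        step : ∀ n → (∀ {m} → m ℕ.< n → Fixed m) → Fixed n
        step n rec {x} {f} x∈ ann with em {P = IsSimpleRootOver K x}
        ... | yes simple = fixes-separable x∈ simple
        ... | no inseparable =
          let m , n₀ , m-ann , m-minimal = minimal {K} id x
              p , char , k , k<n₀ , g , g-ann = p-th-power-degree inseparable m-ann m-minimal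
          in frobenius-injective char (trans (sym (^-homo (ℕ.suc p) (E≤L x∈)))
               (rec (ℕₚ.<-≤-trans k<n₀ (m-minimal n f ann)) {f = g} (^-closed E (ℕ.suc p) x∈) g-ann))

      fixes-separable⇒fixes : ∀ {x} → x ∈ ∣ E ∣ → σ x ≈ x
      fixes-separable⇒fixes {x} x∈ = let n , f , ann = proj₂ closure x in <-rec Fixed step n {x} {f} x∈ ann

  -- Counting distinct roots

  fromRoots-monic : ∀ rs → MonicOfDegree (length rs) (fromRoots rs)
  fromRoots-monic []       = refl , λ { (ℕ.suc i) _ → refl }
  fromRoots-monic (r ∷ rs) = let monic , above = fromRoots-monic rs in
      trans (coeff-linear-⊠ r (fromRoots rs) (length rs))
        (trans (+-cong (trans (*-congˡ (above _ (ℕₚ.n<1+n _))) (zeroʳ _)) monic) (+-identityˡ 1#))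
    , λ { (ℕ.suc i) (s≤s n<i) → trans (coeff-linear-⊠ r (fromRoots rs) i)
        (trans (+-cong (trans (*-congˡ (above _ (ℕₚ.m<n⇒m<1+n n<i))) (zeroʳ _)) (above i n<i)) (+-identityˡ 0#)) }

  fromRoots-closed : ∀ E {rs} → All ∣ E ∣ rs → All ∣ E ∣ (fromRoots rs)
  fromRoots-closed E []         = Subfield.1∈ E ∷ []
  fromRoots-closed E (r∈ ∷ rs∈) = ⊠-closed E (Subfield.-‿closed E r∈ ∷ Subfield.1∈ E ∷ []) (fromRoots-closed E rs∈)

  too-many-roots : ∀ rs {p} → Unique rs → DegreeBelow (length rs) p → All (λ r → eval p r ≈ 0#) rs → p ≋ []
  too-many-roots []       unique deg vanishing i = deg i z≤n
  too-many-roots (r ∷ rs) {p} (r∉rs ∷ unique) deg (pr≈0 ∷ vanishing) i =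
    trans (factor {p} pr≈0 i) (trans (linear-⊠-cong r {q} {[]} q≋[] i) (zero-product i))
    where
    q = quotient r p
    q-vanishing : ∀ {rs} → All (λ s → ¬ r ≈ s) rs → All (λ s → eval p s ≈ 0#) rs → All (λ s → eval q s ≈ 0#) rs
    q-vanishing []        []           = []
    q-vanishing {s ∷ _} (r≉s ∷ r∉) (ps≈0 ∷ ps) = *-cancelˡ-nonZero (λ s-r≈0 → r≉s (sym (x-y≈0⇒x≈y s r s-r≈0)))
      (trans (*-congʳ (sym (eval-linear r s)))
          (trans (sym (eval-⊠ (linear r) q s)) (trans (sym (eval-≋ {p} {linear r ⊠ q} (factor {p} pr≈0) s)) ps≈0)))
      ∷ q-vanishing r∉ ps
    q≋[] : q ≋ []
    q≋[] = too-many-roots rs {q} unique (quotient-degree (length rs) r p deg) (q-vanishing r∉rs vanishing)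
    zero-product : linear r ⊠ [] ≋ []
    zero-product ℕ.zero    = refl
    zero-product (ℕ.suc ℕ.zero) = refl
    zero-product (ℕ.suc (ℕ.suc i)) = refl

  coeffs∈⇒All : ∀ {P : Pred Carrier (c ⊔ ℓ₁)} p → (∀ i → coeff p i ∈ P) → All P p
  coeffs∈⇒All []      p∈ = []
  coeffs∈⇒All (a ∷ p) p∈ = p∈ 0 ∷ coeffs∈⇒All p (λ i → p∈ (ℕ.suc i))

  -- Used with `Q` the membership in L: the minimal polynomial of an element of L may have repeated
  -- roots and roots outside L, and Artin's product must omit both.
  distinct-members : ∀ {Q : Pred Carrier (c ⊔ ℓ₁)} ss →
    ∃[ rs ] Unique rs × All (λ r → Any (r ≈_) ss × r ∈ Q) rs ×
        (∀ {x} → Any (x ≈_) ss → Q Respects _≈_ → x ∈ Q → Any (x ≈_) rs)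
  distinct-members [] = [] , [] , [] , λ ()
  distinct-members {Q} (s ∷ ss) with distinct-members {Q} ss | em {P = s ∈ Q}
  ... | rs , unique , members , complete | no s∉ =
        rs , unique , All.map (λ (r∈ , r∈Q) → there r∈ , r∈Q) members
      , λ { (here x≈s) resp x∈Q → ⊥-elim (s∉ (resp x≈s x∈Q)) ; (there x∈) resp x∈Q → complete x∈ resp x∈Q }
  ... | rs , unique , members , complete | yes s∈ with em {P = Any (s ≈_) rs}
  ...   | yes s∈rs = rs , unique , All.map (λ (r∈ , r∈Q) → there r∈ , r∈Q) members
      , λ { (here x≈s) resp x∈Q → Any.map (trans x≈s) s∈rs ; (there x∈) resp x∈Q → complete x∈ resp x∈Q }
  ...   | no s∉rs = s ∷ rs , ¬Any⇒All¬ rs s∉rs ∷ unique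
      , (here refl , s∈) ∷ All.map (λ (r∈ , r∈Q) → there r∈ , r∈Q) members
      , λ { (here x≈s) resp x∈Q → here x≈s ; (there x∈) resp x∈Q → there (complete x∈ resp x∈Q) }

  -- Automorphisms and Artin's theorem

  module Automorphisms (K : Subfield) (closure : IsAlgebraicClosureOf K) (L : Subfield)
      (L/K : IsFiniteExtension L K) where
    open Embeddings K closure L L/K public
    open Separability K closure
    open Inseparability K closure

    module _ (α : Aut L K) where
      open Aut α
      open RingMorphisms (rawRing L) (rawRing L) using (module IsRingIsomorphism)
      open IsRingIsomorphism isRingIsomorphism

      toFunction : Carrier → Carrier
      toFunction y with em {P = y ∈ ∣ L ∣}
      ... | yes y∈ = proj₁ (⟦_⟧ (y , y∈))
      ... | no _   = 0#

      toFunction≈ : ∀ {y} (y∈ : y ∈ ∣ L ∣) → toFunction y ≈ proj₁ (⟦_⟧ (y , y∈))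
      toFunction≈ {y} y∈ with em {P = y ∈ ∣ L ∣}
      ... | yes y∈′ = ⟦⟧-cong refl
      ... | no y∉   = ⊥-elim (y∉ y∈)

      toFunction∈ : ∀ {y} → y ∈ ∣ L ∣ → toFunction y ∈ ∣ L ∣
      toFunction∈ y∈ = Subfield.resp L (sym (toFunction≈ y∈)) (proj₂ (⟦_⟧ (_ , y∈)))

      toEmbedding : IsEmbedding K toFunction
      toEmbedding = record
        { isHom = record
          { cong   = λ x∈ x≈y → let y∈ = Subfield.resp L x≈y x∈ in
              trans (toFunction≈ x∈) (trans (⟦⟧-cong {_ , x∈} {_ , y∈} x≈y) (sym (toFunction≈ y∈)))
          ; +-homo = λ x∈ y∈ → trans (toFunction≈ (Subfield.+-closed L x∈ y∈))
              (trans (+-homo (_ , x∈) (_ , y∈)) (sym (+-cong (toFunction≈ x∈) (toFunction≈ y∈))))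
          ; *-homo = λ x∈ y∈ → trans (toFunction≈ (Subfield.*-closed L x∈ y∈))
              (trans (*-homo (_ , x∈) (_ , y∈)) (sym (*-cong (toFunction≈ x∈) (toFunction≈ y∈))))
          ; 1-homo = trans (toFunction≈ (Subfield.1∈ L)) 1#-homo
          }
        ; fixes = λ a∈ → trans (toFunction≈ (K≤L a∈)) (fixes (_ , K≤L a∈) a∈)
        }

    module _ {σ} (h : IsEmbedding K σ) (stable : ∀ {x} → x ∈ ∣ L ∣ → σ x ∈ ∣ L ∣) where
      open IsEmbedding h

      private
        iterate : ℕ → Carrier → Carrier
        iterate ℕ.zero    y = y
        iterate (ℕ.suc n) y = σ (iterate n y)

        iterate∈ : ∀ n {y} → y ∈ ∣ L ∣ → iterate n y ∈ ∣ L ∣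
        iterate∈ ℕ.zero    y∈ = y∈
        iterate∈ (ℕ.suc n) y∈ = stable (iterate∈ n y∈)

        iterate-root : ∀ {p} → All ∣ K ∣ p → ∀ n {y} → y ∈ ∣ L ∣ → eval p y ≈ 0# → eval p (iterate n y) ≈ 0#
        iterate-root p∈ ℕ.zero    y∈ py≈0 = py≈0
        iterate-root p∈ (ℕ.suc n) y∈ py≈0 = embedding-root K≤L h p∈ (iterate∈ n y∈) (iterate-root p∈ n y∈ py≈0)

        -- Injectivity cancels σ from both iterates until the shorter one is `y` itself; the longer
        -- one still begins with a σ.
        preimage : ∀ {i j y} → y ∈ ∣ L ∣ → i ℕ.< j → iterate i y ≈ iterate j y → ∃[ x ] x ∈ ∣ L ∣ × σ x ≈ y
        preimage {ℕ.zero}  {ℕ.suc j} y∈ _         e = iterate j _ , iterate∈ j y∈ , sym e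
        preimage {ℕ.suc i} {ℕ.suc j} y∈ (s≤s i<j) e =
            preimage y∈ i<j (hom-injective isHom (iterate∈ i y∈) (iterate∈ j y∈) e)

      -- The iterates of y under σ are among the finitely many conjugates of y.
      embedding-surjective : ∀ {y} → y ∈ ∣ L ∣ → ∃[ x ] x ∈ ∣ L ∣ × σ x ≈ y
      embedding-surjective {y} y∈ =
        let p , p-minimal@(_ , (p∈ , _ , py≈0) , _) = minimal {K} id y
            rs , p≋ = roots {K} {y} {p} p-minimal
            position : ∀ n → Any (iterate n y ≈_) rs
            position n = root∈fromRoots rs (trans (sym (eval-≋ {p} {fromRoots rs} p≋ (iterate n y)))
                (iterate-root p∈ n y∈ py≈0))
            i , j , i<j , same = pigeonhole (ℕₚ.n<1+n (length rs)) (λ n → Any.index (position (toℕ n)))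
        in preimage y∈ i<j (trans (lookup-index (position (toℕ i)))
             (trans (reflexive (≡.cong (List.lookup rs) same)) (sym (lookup-index (position (toℕ j))))))

      toAut : Aut L K
      toAut = record
        { ⟦_⟧ = λ (x , x∈) → σ x , stable x∈
        ; isRingIsomorphism = record
          { isRingMonomorphism = record
            { isRingHomomorphism = record
              { isSemiringHomomorphism = record
                { isNearSemiringHomomorphism = record
                  { +-isMonoidHomomorphism = record
                    { isMagmaHomomorphism = record
                      { isRelHomomorphism = record { cong = λ { {x , x∈} x≈y → cong x∈ x≈y } }
                      ; homo = λ (_ , x∈) (_ , y∈) → +-homo x∈ y∈
                      }
                    ; ε-homo = 0-homo
                    }
                  ; *-homo = λ (_ , x∈) (_ , y∈) → *-homo x∈ y∈
                  }
                ; 1#-homo = 1-homo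
                }
              ; -‿homo = λ (_ , x∈) → -‿homo x∈
              }
            ; injective = λ { {_ , x∈} {_ , y∈} → hom-injective isHom x∈ y∈ }
            }
          ; surjective = λ (y , y∈) → let x , x∈ , σx≈y = embedding-surjective y∈ in
              (x , x∈) , λ { {_ , z∈} z≈x → trans (cong z∈ z≈x) σx≈y }
          }
        ; fixes = λ _ a∈ → fixes a∈
        }

    normal⇒fixedField≤fixedByEmbeddings : IsNormal L K → fixedField L K ⊆ ∣ fixedByEmbeddings ∣
    normal⇒fixedField≤fixedByEmbeddings normal (x∈ , fixed) =
        x∈ , λ h → fixed (toAut h (normal⇒stable {K} {L} K≤L id normal h))

    -- Artin's theorem: the product of X - r over the distinct K-conjugates r of
    -- x in L is fixed by every automorphism.
    module _ {M} (K≤M : K ≤ M) (fixedField⊆M : fixedField L K ⊆ ∣ M ∣) where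

      conjugates : ∀ {x} → x ∈ ∣ L ∣ → ∃[ rs ] Unique rs × (All ∣ L ∣ rs) × Any (x ≈_) rs × (All ∣ M ∣ (fromRoots rs))
      conjugates {x} x∈ =
        let f , f-minimal@(_ , (f∈ , _ , fx≈0) , _) = minimal {K} id x
            ss , f≋ = roots {K} {x} {f} f-minimal
            in-ss : ∀ {y} → eval f y ≈ 0# → Any (y ≈_) ss
            in-ss {y} fy≈0 = root∈fromRoots ss (trans (sym (eval-≋ {f} {fromRoots ss} f≋ y)) fy≈0)
            rs , unique , members , complete = distinct-members {∣ L ∣} ss
            rs∈L = All.map proj₂ members
            permuted : ∀ α → All (λ r → Any (toFunction α r ≈_) rs) rs
            permuted α = All.map (λ {r} (r∈ss , r∈) →
              complete (in-ss (embedding-root K≤L (toEmbedding α) f∈ r∈ (≋-root {f} {ss} f≋ r∈ss))) (Subfield.resp L)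
                  (toFunction∈ α r∈)) members
        in rs , unique , rs∈L , complete (in-ss fx≈0) (Subfield.resp L) x∈
         , coeffs∈⇒All (fromRoots rs) (λ i → fixedField⊆M (coeff∈ L (fromRoots-closed L rs∈L) i , λ α →
             trans (sym (toFunction≈ α _)) (sym (invariant α rs unique rs∈L (permuted α) i))))
        where
        -- Rather than rearranging a product over a permuted list, roots are counted: `g` and its
        -- image under σ are monic of the same degree, so their difference `d` has degree below the
        -- number of roots. Yet it vanishes at every σ r, which is a root of `g` by `permuted` and
        -- of the image because g(r) = 0; these points are distinct by injectivity.
        invariant : ∀ α rs → Unique rs → All ∣ L ∣ rs → All (λ r → Any (toFunction α r ≈_) rs) rs →
                    ∀ i → coeff (fromRoots rs) i ≈ toFunction α (coeff (fromRoots rs) i)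
        invariant α rs unique rs∈ permuted i =
            trans (x-y≈0⇒x≈y _ _ (trans (sym (difference i)) (vanishes i))) (coeff-map isHom g∈ i)
          where
          open IsEmbedding (toEmbedding α)
          σ = toFunction α
          g = fromRoots rs
          g∈ = fromRoots-closed L rs∈
          d = g ⊞ map (- 1# *_) (map σ g)
          difference : ∀ i → coeff d i ≈ coeff g i - coeff (map σ g) i
          difference i = trans (coeff-⊞ g (map (- 1# *_) (map σ g)) i) (+-congˡ (trans (coeff-scale (- 1#) (map σ g) i)
            (trans (sym (-‿distribˡ-* 1# _)) (-‿cong (*-identityˡ _)))))
          σrs-unique : ∀ {rs} → All ∣ L ∣ rs → Unique rs → Unique (map σ rs)
          σrs-unique []         []            = []
          σrs-unique (r∈ ∷ rs∈) (r∉ ∷ unique) = map⁺ (apart rs∈ r∉) ∷ σrs-unique rs∈ unique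
            where
            apart : ∀ {ss} → All ∣ L ∣ ss → All (λ s → ¬ _ ≈ s) ss → All (λ s → ¬ σ _ ≈ σ s) ss
            apart []         []         = []
            apart (s∈ ∷ ss∈) (r≉s ∷ r∉) = (λ σr≈σs → r≉s (hom-injective isHom r∈ s∈ σr≈σs)) ∷ apart ss∈ r∉
          d-degree : DegreeBelow (length rs) d
          d-degree i n≤i = trans (difference i) (split-≤ {P = λ i → coeff g i - coeff (map σ g) i ≈ 0#}
            (x≈y⇒x-y≈0 (trans (proj₁ g-monic) (sym (proj₁ σg-monic))))
            (λ j n<j → x≈y⇒x-y≈0 (trans (proj₂ g-monic j n<j) (sym (proj₂ σg-monic j n<j)))) n≤i)
            where
            g-monic = fromRoots-monic rs
            σg-monic = map-monic isHom g∈ g-monic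
          d-root : ∀ {r} → r ∈ ∣ L ∣ → eval g r ≈ 0# → eval g (σ r) ≈ 0# → eval d (σ r) ≈ 0#
          d-root {r} r∈ gr≈0 gσr≈0 = trans (eval-⊞ g (map (- 1# *_) (map σ g)) (σ r)) (trans (+-cong gσr≈0
            (trans (eval-scale (- 1#) (map σ g) (σ r)) (trans (*-congˡ (trans (sym (evalAt≈eval-map isHom g (σ r)))
              (trans (sym (Self.hom-eval isHom g∈ r∈)) (trans (cong (Self.eval∈ (id-hom L) g∈ r∈) gr≈0) 0-homo))))
                  (zeroʳ _)))) (+-identityˡ 0#))
          vanishes : d ≋ []
          vanishes = too-many-roots (map σ rs) {d} (σrs-unique rs∈ unique)
            (≡.subst (λ n → DegreeBelow n d) (≡.sym (length-map σ rs)) d-degree)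
            (map⁺ (All.tabulate λ {r} r∈ → d-root (All.lookup rs∈ r∈) (fromRoots-root {rs} (Any.map reflexive r∈))
                (fromRoots-root {rs} (All.lookup permuted r∈))))

      fixedField⇒galois : IsGalois L M
      fixedField⇒galois = normal , λ x∈ → separable x∈
        where
        normal : IsNormal L M
        normal {x} x∈ =
          let m , m-minimal = minimal {M} K≤M x
              ss , m≋ = roots {M} {x} {m} m-minimal
              rs , _ , rs∈ , x∈rs , g∈ = conjugates x∈
          in m , m-minimal , ss
           -- The minimal polynomial over `M` divides the orbit polynomial, expressed through roots:
           -- a root of `m` is a root of every polynomial over `M` that vanishes at `x`, and the
           -- orbit polynomial has all its roots in L.
           , All.tabulateₛ setoid (λ {r} r∈ → All.lookupₛ setoid (Subfield.resp L) rs∈ (root∈fromRoots rs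
               (relation-transfers Ωᴿ (id-hom M) {x} m-minimal (≋-root {m} {ss} m≋ r∈) g∈ (fromRoots-root x∈rs))))
           , m≋
        separable : IsSeparable L M
        separable {x} x∈ =
          let rs , unique , _ , x∈rs , g∈ = conjugates x∈
          in simpleRoot⇒separable {M} K≤M (fromRoots rs , g∈ , fromRoots-root x∈rs , unique⇒simple rs unique x∈rs)

    module _ {Lᵢ} (isLᵢ : IsLargestSubextension IsPurelyInseparable L K Lᵢ) where
      open IsLargestSubextension isLᵢ

      fixedByEmbeddings≤Lᵢ : fixedByEmbeddings ≤ Lᵢ
      fixedByEmbeddings≤Lᵢ = largest fixedByEmbeddings
        (λ a∈ → K≤L a∈ , λ h → IsEmbedding.fixes h a∈) proj₁ fixedByEmbeddings-purelyInseparable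

      -- Separable elements of `Lᵢ` lie in `K` and so are fixed; Frobenius descent extends this to
      -- the rest of `Lᵢ`.
      embedding-over-Lᵢ : ∀ {σ} → IsEmbedding K σ → IsEmbedding Lᵢ σ
      embedding-over-Lᵢ h = record
        { isHom = isHom
        ; fixes = fixes-separable⇒fixes {Lᵢ} {L} K≤E E≤L isHom
              (λ x∈ simple → fixes (proj₂ (property x∈) (simpleRoot⇒separable {K} id simple)))
        }
        where open IsEmbedding h

      normal⇒fixedField : IsNormal L K → fixedField L K ≐ ∣ Lᵢ ∣
      normal⇒fixedField normal =
          (λ x∈ → fixedByEmbeddings≤Lᵢ (normal⇒fixedField≤fixedByEmbeddings normal x∈))
        , (λ x∈ → E≤L x∈ , λ α → trans (sym (toFunction≈ α (E≤L x∈)))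
              (IsEmbedding.fixes (embedding-over-Lᵢ (toEmbedding α)) x∈))

      -- Embeddings over `K` and over `Lᵢ` are the same, so stability over one base is stability
      -- over the other.
      normalOverLᵢ⇒normal : IsNormal L Lᵢ → IsNormal L K
      normalOverLᵢ⇒normal normal = stable⇒normal {K} {L} id id
          (λ h → normal⇒stable {Lᵢ} {L} E≤L id normal (embedding-over-Lᵢ h))

  -- Linear algebra

  Independent : Subfield → ∀ {n} → (Fin n → Carrier) → Set (c ⊔ ℓ₁)
  Independent E b = ∀ a → (∀ i → a i ∈ ∣ E ∣) → combination a b ≈ 0# → ∀ i → a i ≈ 0#

  Span : Subfield → ∀ {n} → (Fin n → Carrier) → Carrier → Set (c ⊔ ℓ₁)
  Span E {n} b x = Σ[ a ∈ (Fin n → Carrier) ] (∀ i → a i ∈ ∣ E ∣) × x ≈ combination a b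

  sum-zero : ∀ {n} {f : Fin n → Carrier} → (∀ i → f i ≈ 0#) → sum f ≈ 0#
  sum-zero {n} f≈0 = trans (sum-cong-≋ f≈0) (sum-replicate-zero n)

  combination-congˡ : ∀ {n} {a a′ : Fin n → Carrier} (b : Fin n → Carrier) → (∀ i → a i ≈ a′ i) →
      combination a b ≈ combination a′ b
  combination-congˡ b a≈a′ = sum-cong-≋ (λ i → *-congʳ (a≈a′ i))

  combination-+ : ∀ {n} (a a′ b : Fin n → Carrier) →
      combination (λ i → a i + a′ i) b ≈ combination a b + combination a′ b
  combination-+ a a′ b = trans (sum-cong-≋ (λ i → distribʳ (b i) (a i) (a′ i)))
      (∑-distrib-+ (λ i → a i * b i) (λ i → a′ i * b i))

  combination-* : ∀ {n} x (a b : Fin n → Carrier) → combination (λ i → x * a i) b ≈ x * combination a b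
  combination-* x a b = trans (sum-cong-≋ (λ i → *-assoc x (a i) (b i))) (sym (*-distribˡ-sum x (λ i → a i * b i)))

  combination-- : ∀ {n} (a a′ b : Fin n → Carrier) →
      combination (λ i → a i - a′ i) b ≈ combination a b - combination a′ b
  combination-- a a′ b = trans (combination-+ a (λ i → - a′ i) b) (+-congˡ
    (trans (sum-cong-≋ (λ i → sym (trans (sym (*-assoc (- 1#) (a′ i) (b i))) (*-congʳ (-1* (a′ i))))))
      (trans (sym (*-distribˡ-sum (- 1#) (λ i → a′ i * b i))) (-1* _))))
    where
    -1* : ∀ x → - 1# * x ≈ - x
    -1* x = trans (sym (-‿distribˡ-* 1# x)) (-‿cong (*-identityˡ x))

  module LinearAlgebra (E : Subfield) where
    private module E = Subfield E

    independent-head : ∀ {n} {w : Fin (ℕ.suc n) → Carrier} → Independent E w → ¬ w zero ≈ 0#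
    independent-head {w = w} independent w₀≈0 = 1≉0 (independent a (λ { zero → E.1∈ ; (suc i) → E.0∈ })
      (trans (+-cong (trans (*-identityˡ _) w₀≈0) (sum-zero (λ i → zeroˡ (w (suc i))))) (+-identityˡ 0#)) zero)
      where
      a : Fin _ → Carrier
      a zero    = 1#
      a (suc i) = 0#

    independent-tail : ∀ {n} {w : Fin (ℕ.suc n) → Carrier} → Independent E w → Independent E (w ∘ suc)
    independent-tail {w = w} independent a a∈ aw≈0 i = independent (0# Vector.∷ a) (λ { zero → E.0∈ ; (suc i) → a∈ i })
      (trans (+-cong (zeroˡ (w zero)) aw≈0) (+-identityˡ 0#)) (suc i)

    -- Gaussian elimination of the first spanning vector: if some `w j` involves it, multiples of
    -- `w j` clear it from the others, which costs one vector on each side; if none does, it can be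
    -- discarded.
    steinitz : ∀ {n m} {v : Fin n → Carrier} {w : Fin m → Carrier} → (∀ i → Span E v (w i)) → Independent E w → m ℕ.≤ n
    steinitz {m = ℕ.zero}                spans independent = z≤n
    steinitz {n = ℕ.zero}  {m = ℕ.suc m} {w = w} spans independent =
        ⊥-elim (independent-head {w = w} independent (proj₂ (proj₂ (spans zero))))
    steinitz {n = ℕ.suc n} {m = ℕ.suc m} {v} {w} spans independent with em {P = ∃[ j ] ¬ proj₁ (spans j) zero ≈ 0#}
    ... | no none = ℕₚ.m≤n⇒m≤1+n (steinitz {v = v ∘ suc} {w} (λ i →
            let a , a∈ , w≈ = spans i in
            a ∘ suc , a∈ ∘ suc , trans w≈ (trans
                (+-congʳ (trans (*-congʳ (classical λ a₀≉0 → none (i , a₀≉0))) (zeroˡ _))) (+-identityˡ _)))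
          independent)
    ... | yes (j , pivot≉0) = s≤s (steinitz {v = v ∘ suc} {w′} w′-spans w′-independent)
      where
      A = λ i → proj₁ (spans i)
      A∈ = λ i → proj₁ (proj₂ (spans i))
      w≈ = λ i → proj₂ (proj₂ (spans i))
      p⁻¹ = proj₁ (invert pivot≉0)
      ρ : Fin m → Carrier
      ρ i = A (punchIn j i) zero * p⁻¹
      ρ∈ : ∀ i → ρ i ∈ ∣ E ∣
      ρ∈ i = E.*-closed (A∈ (punchIn j i) zero) (E.⁻¹-closed (A∈ j zero) (proj₂ (invert pivot≉0)))
      w′ : Fin m → Carrier
      w′ i = w (punchIn j i) - ρ i * w j
      w′-spans : ∀ i → Span E (v ∘ suc) (w′ i)
      w′-spans i = (λ k → A (punchIn j i) (suc k) - ρ i * A j (suc k))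
        , (λ k → E.+-closed (A∈ (punchIn j i) (suc k)) (E.-‿closed (E.*-closed (ρ∈ i) (A∈ j (suc k)))))
        , (begin
            w (punchIn j i) - ρ i * w j
              ≈⟨ +-cong (w≈ (punchIn j i)) (-‿cong (*-congˡ (w≈ j))) ⟩
            (A (punchIn j i) zero * v zero + S) - ρ i * (A j zero * v zero + T)
              ≈⟨ solve 6 (λ a v s q b t → (a :* v :+ s) :- a :* q :* (b :* v :+ t) := a :* v :- a :* (b :* q) :* v :+
                  (s :- a :* q :* t)) refl
                   (A (punchIn j i) zero) (v zero) S p⁻¹ (A j zero) T ⟩
            A (punchIn j i) zero * v zero - A (punchIn j i) zero * (A j zero * p⁻¹) * v zero + (S - ρ i * T)
              ≈⟨ +-congʳ (x≈y⇒x-y≈0 (*-congʳ (sym (trans (*-congˡ (proj₂ (invert pivot≉0))) (*-identityʳ _))))) ⟩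
            0# + (S - ρ i * T)
              ≈⟨ trans (+-identityˡ _) (+-congˡ (-‿cong (sym (combination-* (ρ i) (A j ∘ suc) (v ∘ suc))))) ⟩
            S - combination (λ k → ρ i * A j (suc k)) (v ∘ suc)
              ≈⟨ combination-- (A (punchIn j i) ∘ suc) (λ k → ρ i * A j (suc k)) (v ∘ suc) ⟨
            combination (λ k → A (punchIn j i) (suc k) - ρ i * A j (suc k)) (v ∘ suc) ∎)
        where
        open ≈-Reasoning
        S = combination (A (punchIn j i) ∘ suc) (v ∘ suc)
        T = combination (A j ∘ suc) (v ∘ suc)
      w′-independent : Independent E w′
      w′-independent b b∈ bw′≈0 i = trans (reflexive (≡.sym (insertAt-punchIn b j bⱼ i)))
          (independent a a∈ aw≈0 (punchIn j i))
        where
        open ≈-Reasoning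
        -- A relation among the `w′ i` becomes one among the `w k` once the multiples of `w j` are
        -- collected; this is the coefficient that `w j` receives.
        bⱼ = - combination b ρ
        a : Fin (ℕ.suc m) → Carrier
        a = Vector.insertAt b j bⱼ
        a∈ : ∀ k → a k ∈ ∣ E ∣
        a∈ k with j Fin.≟ k
        ... | yes ≡.refl = ≡.subst (_∈ ∣ E ∣) (≡.sym (insertAt-lookup b j bⱼ)) (E.-‿closed (combination-closed E b∈ ρ∈))
        ... | no j≢k = ≡.subst (λ k → a k ∈ ∣ E ∣) (punchIn-punchOut j≢k)
                (≡.subst (_∈ ∣ E ∣) (≡.sym (insertAt-punchIn b j bⱼ (punchOut j≢k))) (b∈ (punchOut j≢k)))
        aw≈0 : combination a w ≈ 0#
        aw≈0 = begin
          combination a w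
            ≈⟨ sum-remove {i = j} (λ k → a k * w k) ⟩
          a j * w j + combination (a ∘ punchIn j) (w ∘ punchIn j)
            ≈⟨ +-cong (*-congʳ (reflexive (insertAt-lookup b j bⱼ)))
                (combination-congˡ (w ∘ punchIn j) (λ i → reflexive (insertAt-punchIn b j bⱼ i))) ⟩
          - combination b ρ * w j + combination b (w ∘ punchIn j)
            ≈⟨ solve 3 (λ r w s → :- r :* w :+ s := s :- r :* w) refl (combination b ρ) (w j) _ ⟩
          combination b (w ∘ punchIn j) - combination b ρ * w j
            ≈⟨ +-congˡ (-‿cong (trans (*-distribʳ-sum (w j) (λ i → b i * ρ i))
                (sum-cong-≋ (λ i → *-assoc (b i) (ρ i) (w j))))) ⟩
          combination b (w ∘ punchIn j) - combination b (λ i → ρ i * w j)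
            ≈⟨ +-cong (flip b (w ∘ punchIn j)) (-‿cong (flip b (λ i → ρ i * w j))) ⟩
          combination (w ∘ punchIn j) b - combination (λ i → ρ i * w j) b
            ≈⟨ combination-- (w ∘ punchIn j) (λ i → ρ i * w j) b ⟨
          combination w′ b
            ≈⟨ flip w′ b ⟩
          combination b w′
            ≈⟨ bw′≈0 ⟩
          0# ∎
          where
          flip : ∀ {n} (x y : Fin n → Carrier) → combination x y ≈ combination y x
          flip x y = sum-cong-≋ (λ i → *-comm (x i) (y i))

    extend-independent : ∀ {n} {w : Fin n → Carrier} → Independent E w → ∀ {x} → ¬ Span E w x →
        Independent E (x Vector.∷ w)
    extend-independent {w = w} independent {x} x∉ a a∈ ax+aw≈0 with em {P = a zero ≈ 0#}
    ... | yes a₀≈0 = λ { zero → a₀≈0 ; (suc i) → independent (a ∘ suc) (a∈ ∘ suc)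
            (trans (sym (trans (+-congʳ (trans (*-congʳ a₀≈0) (zeroˡ x))) (+-identityˡ _))) ax+aw≈0) i }
    ... | no a₀≉0 = let b , a₀b≈1 = invert a₀≉0 in ⊥-elim (x∉ ((λ i → - b * a (suc i))
            , (λ i → E.*-closed (E.-‿closed (E.⁻¹-closed (a∈ zero) a₀b≈1)) (a∈ (suc i)))
            , (begin
                x                          ≈⟨ trans (*-congʳ a₀b≈1) (*-identityˡ x) ⟨
                a zero * b * x             ≈⟨ solve 4 (λ a b x s → a :* b :* x := b :* (a :* x :+ s) :- b :* s) refl
                    (a zero) b x (combination (a ∘ suc) w) ⟩
                b * (a zero * x + combination (a ∘ suc) w) - b * combination (a ∘ suc) w
                                           ≈⟨ +-congʳ (trans (*-congˡ ax+aw≈0) (zeroʳ b)) ⟩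
                0# - b * combination (a ∘ suc) w ≈⟨ trans (+-identityˡ _) (-‿distribˡ-* b _) ⟩
                - b * combination (a ∘ suc) w ≈⟨ combination-* (- b) (a ∘ suc) w ⟨
                combination (λ i → - b * a (suc i)) w ∎)))
      where open ≈-Reasoning

    -- A vector outside the span of `b` could be added to it, giving n + 1 independent vectors in
    -- the span of the n vectors `v`.
    spanning-of-size : ∀ {F n} {b v : Fin n → Carrier} → (∀ {x} → x ∈ ∣ F ∣ → Span E v x) → (∀ i → b i ∈ ∣ F ∣) →
                       Independent E b → ∀ {x} → x ∈ ∣ F ∣ → Span E b x
    spanning-of-size {b = b} {v} v-spans b∈ independent {x} x∈ = classical λ x∉ → ℕₚ.1+n≰n
      (steinitz {v = v} {x Vector.∷ b} (λ { zero → v-spans x∈ ; (suc i) → v-spans (b∈ i) })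
          (extend-independent independent x∉))

    bounded⇒finiteBasis : ∀ F N → (∀ {m} {w : Fin m → Carrier} → (∀ i → w i ∈ ∣ F ∣) → Independent E w → m ℕ.≤ N) →
        HasFiniteBasis F E
    bounded⇒finiteBasis F N bounded = grow N {0} {λ ()} ℕₚ.≤-refl (λ ()) (λ _ _ _ ())
      where
      -- Vectors outside the current span are added while there are any; `k` is how many more the
      -- bound `N` permits.
      grow : ∀ k {m} {w : Fin m → Carrier} → N ℕ.≤ m ℕ.+ k → (∀ i → w i ∈ ∣ F ∣) → Independent E w → HasFiniteBasis F E
      grow k {m} {w} N≤m+k w∈ independent with em {P = ∃[ x ] x ∈ ∣ F ∣ × ¬ Span E w x}
      ... | no none = m , w , record
            { b∈L = w∈ ; spanning = λ x∈ → classical (λ x∉ → none (_ , x∈ , x∉)) ; independent = independent }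
      ... | yes (x , x∈ , x∉) with k
      ...   | ℕ.zero = ⊥-elim (ℕₚ.1+n≰n (ℕₚ.≤-trans
            (bounded {w = x Vector.∷ w} (λ { zero → x∈ ; (suc i) → w∈ i }) (extend-independent independent x∉))
                (≡.subst (N ℕ.≤_) (ℕₚ.+-identityʳ m) N≤m+k)))
      ...   | ℕ.suc k = grow k {ℕ.suc m} {x Vector.∷ w} (≡.subst (N ℕ.≤_) (ℕₚ.+-suc m k) N≤m+k)
                (λ { zero → x∈ ; (suc i) → w∈ i }) (extend-independent independent x∉)

    subspace-finiteBasis : ∀ {F L} → F ≤ L → HasFiniteBasis L E → HasFiniteBasis F E
    subspace-finiteBasis {F} F≤L (n , b , basis) = bounded⇒finiteBasis F n
      (λ {_} {w} w∈ → steinitz {v = b} {w} (λ i → IsBasis.spanning basis (F≤L (w∈ i))))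

    bases-equinumerous : ∀ {F m n} {b : Fin m → Carrier} {v : Fin n → Carrier} → IsBasis F E b → IsBasis F E v → m ≡ n
    bases-equinumerous {b = b} {v} B V = ℕₚ.≤-antisym
      (steinitz {v = v} {b} (λ i → V.spanning (B.b∈L i)) B.independent)
          (steinitz {v = b} {v} (λ i → B.spanning (V.b∈L i)) V.independent)
      where
      module B = IsBasis B
      module V = IsBasis V

    degree≡ : ∀ {F n} {b : Fin n → Carrier} → IsBasis F E b → [ F ∶ E ] ≡ n
    degree≡ {F} {n} {b} basis with em {P = HasFiniteBasis F E}
    ... | yes (_ , _ , basis′) = bases-equinumerous basis′ basis
    ... | no none = ⊥-elim (none (n , b , basis))

    -- A positive value is not the default 0, so it is the size of an actual basis.
    nonZero-degree⇒basis : ∀ F {n} → [ F ∶ E ] ≡ ℕ.suc n → Σ[ b ∈ (Fin (ℕ.suc n) → Carrier) ] IsBasis F E b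
    nonZero-degree⇒basis F deg with em {P = HasFiniteBasis F E}
    nonZero-degree⇒basis F ≡.refl | yes (_ , b , basis) = b , basis
    nonZero-degree⇒basis F ()     | no _

    basis-nonEmpty : ∀ {F} {b : Fin 0 → Carrier} → ¬ IsBasis F E b
    basis-nonEmpty {F} basis = 1≉0 (proj₂ (proj₂ (IsBasis.spanning basis (Subfield.1∈ F))))

  -- Linear disjointness of F and Lᵢ

  module LinearDisjointness (K : Subfield) (closure : IsAlgebraicClosureOf K) (L : Subfield)
      (L/K : IsFiniteExtension L K)
    (Lᵢ : Subfield) (isLᵢ : IsLargestSubextension IsPurelyInseparable L K Lᵢ)
    (F : Subfield) (K≤F : K ≤ F) (F≤L : F ≤ L) (galois : IsGalois F K) where
    open Automorphisms K closure L L/K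
    open LinearAlgebra
    private
      module Lᵢ = IsLargestSubextension isLᵢ
      module F = Subfield F

      hom-combination : ∀ {σ} → IsEmbedding K σ → ∀ {n} {a e : Fin n → Carrier} → (∀ i → a i ∈ ∣ L ∣) →
          (∀ i → e i ∈ ∣ Lᵢ ∣) →
                        σ (combination a e) ≈ combination (σ ∘ a) e
      hom-combination h {ℕ.zero}  a∈ e∈ = IsEmbedding.0-homo h
      hom-combination h {ℕ.suc n} a∈ e∈ =
        trans (+-homo (Subfield.*-closed L (a∈ zero) (Lᵢ.E≤L (e∈ zero)))
            (combination-closed L (a∈ ∘ suc) (Lᵢ.E≤L ∘ e∈ ∘ suc)))
          (+-cong (trans (*-homo (a∈ zero) (Lᵢ.E≤L (e∈ zero))) (*-congˡ (fixes (e∈ zero))))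
            (hom-combination h (a∈ ∘ suc) (e∈ ∘ suc)))
        where open IsEmbedding (embedding-over-Lᵢ isLᵢ h)

    -- Embeddings fix e but move the coefficients of a shortest relation over F,
    -- so its coefficients lie in K once one of them is 1.
    independent-over-F : ∀ {n} {e : Fin n → Carrier} → (∀ i → e i ∈ ∣ Lᵢ ∣) → Independent K e → Independent F e
    independent-over-F {ℕ.suc n} {e} e∈ independent f f∈ fe≈0 with em {P = f zero ≈ 0#}
    ... | yes f₀≈0 = λ { zero → f₀≈0 ; (suc i) →
          independent-over-F (e∈ ∘ suc) (independent-tail K {w = e} independent) (f ∘ suc) (f∈ ∘ suc)
            (trans (sym (trans (+-congʳ (trans (*-congʳ f₀≈0) (zeroˡ _))) (+-identityˡ _))) fe≈0) i }
    ... | no f₀≉0 = ⊥-elim (1≉0 (independent (1# Vector.∷ g) (λ { zero → Subfield.1∈ K ; (suc i) → g∈K i })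
            (trans (+-congʳ (*-identityˡ _)) relation) zero))
      where
      b = proj₁ (invert f₀≉0)
      b∈ : b ∈ ∣ F ∣
      b∈ = F.⁻¹-closed (f∈ zero) (proj₂ (invert f₀≉0))
      g : Fin n → Carrier
      g i = b * f (suc i)
      g∈ : ∀ i → g i ∈ ∣ F ∣
      g∈ i = F.*-closed b∈ (f∈ (suc i))
      e′ : Fin n → Carrier
      e′ = e ∘ suc
      relation : e zero + combination g e′ ≈ 0#
      relation = begin
        e zero + combination g e′
          ≈⟨ +-cong (trans (sym (*-identityˡ _)) (*-congʳ (trans (sym (proj₂ (invert f₀≉0))) (*-comm _ _))))
              (combination-* b (f ∘ suc) e′) ⟩
        b * f zero * e zero + b * combination (f ∘ suc) e′
          ≈⟨ +-congʳ (*-assoc b _ _) ⟩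
        b * (f zero * e zero) + b * combination (f ∘ suc) e′
          ≈⟨ distribˡ b _ _ ⟨
        b * combination f e
          ≈⟨ trans (*-congˡ fe≈0) (zeroʳ b) ⟩
        0# ∎
        where open ≈-Reasoning
      -- Subtracting the relation from its image under σ cancels the term of `e zero`. Normality
      -- keeps the differences in `F`, so the shorter relation that remains is covered by the
      -- induction hypothesis and is trivial.
      g-fixed : ∀ {σ} → IsEmbedding K σ → ∀ i → σ (g i) ≈ g i
      g-fixed {σ} h i = x-y≈0⇒x≈y _ _ (independent-over-F (e∈ ∘ suc) (independent-tail K {w = e} independent)
          (λ i → σ (g i) - g i)
        (λ i → F.+-closed (normal⇒stable {K} {F} K≤L F≤L (proj₁ galois) h (g∈ i)) (F.-‿closed (g∈ i)))
        (begin
          combination (λ i → σ (g i) - g i) e′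
            ≈⟨ combination-- (σ ∘ g) g e′ ⟩
          combination (σ ∘ g) e′ - combination g e′
            ≈⟨ solve 3 (λ e s t → s :- t := (e :+ s) :- (e :+ t)) refl (e zero) _ _ ⟩
          (e zero + combination (σ ∘ g) e′) - (e zero + combination g e′)
            ≈⟨ +-cong σ-relation (trans (-‿cong relation) -0≈0) ⟩
          0# + 0#
            ≈⟨ +-identityˡ 0# ⟩
          0# ∎) i)
        where
        open ≈-Reasoning
        open IsEmbedding (embedding-over-Lᵢ isLᵢ h)
        ge∈ : combination g e′ ∈ ∣ L ∣
        ge∈ = combination-closed L (F≤L ∘ g∈) (Lᵢ.E≤L ∘ e∈ ∘ suc)
        e₀∈ : e zero ∈ ∣ L ∣
        e₀∈ = Lᵢ.E≤L (e∈ zero)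
        σ-relation : e zero + combination (σ ∘ g) e′ ≈ 0#
        σ-relation = begin
          e zero + combination (σ ∘ g) e′   ≈⟨ +-cong (fixes (e∈ zero)) (hom-combination h (F≤L ∘ g∈) (e∈ ∘ suc)) ⟨
          σ (e zero) + σ (combination g e′) ≈⟨ +-homo e₀∈ ge∈ ⟨
          σ (e zero + combination g e′)     ≈⟨ cong (Subfield.+-closed L e₀∈ ge∈) relation ⟩
          σ 0#                              ≈⟨ 0-homo ⟩
          0#                                ∎
      g∈K : ∀ i → g i ∈ ∣ K ∣
      g∈K i = fixed-separable⇒base {K} id (λ h → g-fixed h i) (proj₂ galois (g∈ i))

    -- Linear disjointness is symmetric. Expanding each `a i` in a K-basis `e` of `Lᵢ` and
    -- exchanging the sums gives a relation among the `e j` with coefficients in `F`; these vanish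
    -- by `independent-over-F`, and each of them is a K-relation among the `b i`.
    independent-over-Lᵢ : ∀ {m} {b : Fin m → Carrier} → (∀ i → b i ∈ ∣ F ∣) → Independent K b → Independent Lᵢ b
    independent-over-Lᵢ {m} {b} b∈ independent a a∈ ab≈0 i =
      trans (a≈ i) (sum-zero (λ j → trans (*-congʳ (k≈0 j i)) (zeroˡ (e j))))
      where
      open ≈-Reasoning
      basis = subspace-finiteBasis K {Lᵢ} {L} Lᵢ.E≤L (proj₂ L/K)
      n = proj₁ basis
      e = proj₁ (proj₂ basis)
      module e = IsBasis (proj₂ (proj₂ basis))
      k : Fin m → Fin n → Carrier
      k i = proj₁ (e.spanning (a∈ i))
      k∈ : ∀ i j → k i j ∈ ∣ K ∣
      k∈ i = proj₁ (proj₂ (e.spanning (a∈ i)))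
      a≈ : ∀ i → a i ≈ combination (k i) e
      a≈ i = proj₂ (proj₂ (e.spanning (a∈ i)))
      kb≈0 : ∀ j → combination (λ i → k i j) b ≈ 0#
      kb≈0 = independent-over-F e.b∈L e.independent (λ j → combination (λ i → k i j) b)
        (λ j → combination-closed F (λ i → K≤F (k∈ i j)) b∈) (begin
          sum (λ j → sum (λ i → k i j * b i) * e j)
            ≈⟨ sum-cong-≋ (λ j → *-distribʳ-sum (e j) (λ i → k i j * b i)) ⟩
          sum (λ j → sum (λ i → k i j * b i * e j))
            ≈⟨ ∑-comm (λ j i → k i j * b i * e j) ⟩
          sum (λ i → sum (λ j → k i j * b i * e j))
            ≈⟨ sum-cong-≋ (λ i → trans (sum-cong-≋ (λ j → swap (k i j) (b i) (e j)))
                (sym (*-distribʳ-sum (b i) (λ j → k i j * e j)))) ⟩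
          sum (λ i → sum (λ j → k i j * e j) * b i)
            ≈⟨ sum-cong-≋ (λ i → *-congʳ (sym (a≈ i))) ⟩
          combination a b
            ≈⟨ ab≈0 ⟩
          0# ∎)
        where
        swap : ∀ x y z → x * y * z ≈ x * z * y
        swap = solve 3 (λ x y z → x :* y :* z := x :* z :* y) refl
      k≈0 : ∀ j i → k i j ≈ 0#
      k≈0 j = independent (λ i → k i j) (λ i → k∈ i j) (kb≈0 j)

    module _ {n} {b : Fin n → Carrier} (basis : IsBasis F K b) where
      open IsBasis basis

      private
        module Lᵢ′ = Subfield Lᵢ

        -- This span is the compositum of `F` and `Lᵢ`. It is closed under products because a
        -- product of basis vectors lies in `F` and can be expanded again, and a ring over `K` is
        -- already a field.
        A : Pred Carrier (c ⊔ ℓ₁)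
        A = Span Lᵢ b

        A-resp : A Respects _≈_
        A-resp x≈y (a , a∈ , x≈) = a , a∈ , trans (sym x≈y) x≈

        A-+ : ∀ {x y} → x ∈ A → y ∈ A → x + y ∈ A
        A-+ (a , a∈ , x≈) (a′ , a′∈ , y≈) = (λ i → a i + a′ i) , (λ i → Lᵢ′.+-closed (a∈ i) (a′∈ i))
          , trans (+-cong x≈ y≈) (sym (combination-+ a a′ b))

        A-scale : ∀ {x y} → x ∈ ∣ Lᵢ ∣ → y ∈ A → x * y ∈ A
        A-scale {x} x∈ (a , a∈ , y≈) = (λ i → x * a i) , (λ i → Lᵢ′.*-closed x∈ (a∈ i))
          , trans (*-congˡ y≈) (sym (combination-* x a b))

        F⊆A : ∣ F ∣ ⊆ A
        F⊆A x∈ = let a , a∈ , x≈ = spanning x∈ in a , (λ i → Lᵢ.K≤E (a∈ i)) , x≈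

        A-sum : ∀ {m} {f : Fin m → Carrier} → (∀ i → f i ∈ A) → sum f ∈ A
        A-sum {ℕ.zero}  f∈ = F⊆A F.0∈
        A-sum {ℕ.suc m} f∈ = A-+ (f∈ zero) (A-sum (f∈ ∘ suc))

        A-combination : ∀ {m} {a d : Fin m → Carrier} {y} → (∀ i → a i * (d i * y) ∈ A) → combination a d * y ∈ A
        A-combination {a = a} {d} {y} ady∈ = A-resp (trans (sum-cong-≋ (λ i → sym (*-assoc (a i) (d i) y)))
          (sym (*-distribʳ-sum y (λ i → a i * d i)))) (A-sum ady∈)

        A-*F : ∀ {x y} → x ∈ ∣ F ∣ → y ∈ A → y * x ∈ A
        A-*F {x} x∈ (a , a∈ , y≈) = A-resp (*-congʳ (sym y≈))
            (A-combination (λ i → A-scale (a∈ i) (F⊆A (F.*-closed (b∈L i) x∈))))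

        A-* : ∀ {x y} → x ∈ A → y ∈ A → x * y ∈ A
        A-* {x} {y} (a , a∈ , x≈) y∈ = A-resp (*-congʳ (sym x≈))
          (A-combination (λ i → A-scale (a∈ i) (A-resp (*-comm y (b i)) (A-*F (b∈L i) y∈))))

        spanned : Subfield
        spanned = intermediateField A A-resp (F⊆A ∘ K≤F) A-+ A-*

      compositum⇒basis : ∣ L ∣ ⊆ compositum F Lᵢ → IsBasis L Lᵢ b
      compositum⇒basis L⊆ = record
        { b∈L         = λ i → F≤L (b∈L i)
        ; spanning    = λ x∈ → L⊆ x∈ spanned F⊆A (λ {y} y∈ → A-resp (*-identityʳ y) (A-scale y∈ (F⊆A F.1∈)))
        ; independent = independent-over-Lᵢ b∈L independent
        }

      -- The K-basis `b` of `F` stays independent over `Lᵢ` and is as long as the basis `v` of L, so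
      -- it spans L; such combinations lie in every field containing `F` and `Lᵢ`.
      basis-size⇒compositum : ∀ {v : Fin n → Carrier} → IsBasis L Lᵢ v → ∣ L ∣ ⊆ compositum F Lᵢ
      basis-size⇒compositum {v} V x∈ M F≤M Lᵢ≤M =
        let a , a∈ , x≈ = spanning-of-size Lᵢ {L} {b = b} {v} (IsBasis.spanning V) (λ i → F≤L (b∈L i))
              (independent-over-Lᵢ b∈L independent) x∈
        in Subfield.resp M (sym x≈) (combination-closed M (λ i → Lᵢ≤M (a∈ i)) (λ i → F≤M (b∈L i)))

    -- A basis of `F` over `K` cannot be empty, so the common value of the degrees is positive and
    -- comes from a basis of L over `Lᵢ` of the same size.
    degree⇒compositum : [ F ∶ K ] ≡ [ L ∶ Lᵢ ] → ∣ L ∣ ⊆ compositum F Lᵢ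
    degree⇒compositum t≡ = compare (subspace-finiteBasis K {F} {L} F≤L (proj₂ L/K))
      where
      compare : HasFiniteBasis F K → ∣ L ∣ ⊆ compositum F Lᵢ
      compare (ℕ.zero  , b , basis) = ⊥-elim (basis-nonEmpty K {F} {b} basis)
      compare (ℕ.suc n , b , basis) =
        let v , V = nonZero-degree⇒basis Lᵢ L
              (≡.trans (≡.sym t≡) (degree≡ K {F} basis)) in basis-size⇒compositum basis V

    compositum⇒degree : ∣ L ∣ ⊆ compositum F Lᵢ → [ F ∶ K ] ≡ [ L ∶ Lᵢ ]
    compositum⇒degree L⊆ =
      let n , b , basis = subspace-finiteBasis K {F} {L} F≤L (proj₂ L/K)
      in ≡.trans (degree≡ K {F} basis) (≡.sym (degree≡ Lᵢ {L} (compositum⇒basis basis L⊆)))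

    compositum⇒normal : ∣ L ∣ ⊆ compositum F Lᵢ → IsNormal L K
    compositum⇒normal L⊆ = stable⇒normal {K} {L} id id (λ h x∈ → proj₂ (L⊆ x∈ (preserved h)
        (λ y∈ → F≤L y∈ , F≤L (normal⇒stable {K} {F} K≤L F≤L (proj₁ galois) h y∈))
        (λ y∈ → Lᵢ.E≤L y∈ , Subfield.resp L (sym (IsEmbedding.fixes (embedding-over-Lᵢ isLᵢ h) y∈)) (Lᵢ.E≤L y∈))))
      where
      preserved : ∀ {σ} → IsEmbedding K σ → Subfield
      preserved {σ} h = intermediateField (λ x → x ∈ ∣ L ∣ × σ x ∈ ∣ L ∣)
        (λ x≈y (x∈ , σx∈) → Subfield.resp L x≈y x∈ , Subfield.resp L (cong x∈ x≈y) σx∈)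
        (λ a∈ → K≤L a∈ , Subfield.resp L (sym (fixes a∈)) (K≤L a∈))
        (λ (x∈ , σx∈) (y∈ , σy∈) → Subfield.+-closed L x∈ y∈ , Subfield.resp L (sym (+-homo x∈ y∈))
            (Subfield.+-closed L σx∈ σy∈))
        (λ (x∈ , σx∈) (y∈ , σy∈) → Subfield.*-closed L x∈ y∈ , Subfield.resp L (sym (*-homo x∈ y∈))
            (Subfield.*-closed L σx∈ σy∈))
        where open IsEmbedding h

  -- The equivalences

  compositum-monoˡ : ∀ {E F M} → E ≤ F → compositum E M ⊆ compositum F M
  compositum-monoˡ E≤F x∈ N F≤N M≤N = x∈ N (λ y∈ → F≤N (E≤F y∈)) M≤N

  module Characterisations (K : Subfield) (closure : IsAlgebraicClosureOf K) (L : Subfield)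
      (L/K : IsFiniteExtension L K)
    (Lₛ Lᵢ F : Subfield)
    (isLₛ : IsLargestSubextension IsSeparable L K Lₛ)
    (isLᵢ : IsLargestSubextension IsPurelyInseparable L K Lᵢ)
    (isF : IsLargestSubextension IsGalois L K F) where
    open Automorphisms K closure L L/K
    open Separability K closure
    open Inseparability K closure
    private
      module Lₛ = IsLargestSubextension isLₛ
      module Lᵢ = IsLargestSubextension isLᵢ
      module F = IsLargestSubextension isF
    open LinearDisjointness K closure L L/K Lᵢ isLᵢ F F.K≤E F.E≤L F.property public

    -- Maximality of `Lₛ` speaks of fields, so a single separable element is reached through the
    -- separable field K(x).
    simpleRoot∈Lₛ : ∀ {x} → x ∈ ∣ L ∣ → IsSimpleRootOver K x → x ∈ ∣ Lₛ ∣
    simpleRoot∈Lₛ {x} x∈ simple = Lₛ.largest (adjoin K id x) (E≤adjoin K id x) (adjoin-least K id x {L} K≤L x∈)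
      (adjoin-separable {K} id simple) (x∈adjoin K id x)

    -- For `Lₛ` to be Galois only stability is missing: an embedding takes a simple root of `g` to a
    -- simple root of the same `g`, which normality keeps in L and hence in `Lₛ`.
    normal⇒Lₛ≤F : IsNormal L K → Lₛ ≤ F
    normal⇒Lₛ≤F normal = F.largest Lₛ Lₛ.K≤E Lₛ.E≤L
        (stable⇒normal {K} {Lₛ} id Lₛ.E≤L (λ h x∈ → stable h x∈) , Lₛ.property)
      where
      stable : ∀ {σ} → IsEmbedding K σ → ∀ {x} → x ∈ ∣ Lₛ ∣ → σ x ∈ ∣ Lₛ ∣
      stable {σ} h {x} x∈ =
        let g , g∈ , gx≈0 , g′x≉0 = separable⇒simpleRoot {K} (Lₛ.property x∈)
            x∈L = Lₛ.E≤L x∈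
            g′∈ = derivative-closed K g∈
        in simpleRoot∈Lₛ (normal⇒stable {K} {L} K≤L id normal h x∈L)
             (g , g∈ , embedding-root K≤L h g∈ x∈L gx≈0 , λ g′σx≈0 → g′x≉0 (hom-reflects-0 (IsEmbedding.isHom h)
               (Self.eval∈ (id-hom L) (All.map K≤L g′∈) x∈L) (trans (embedding-eval K≤L h g′∈ x∈L) g′σx≈0)))

    normal⇒galoisOverLᵢ : IsNormal L K → IsGalois L Lᵢ
    normal⇒galoisOverLᵢ normal = fixedField⇒galois {Lᵢ} Lᵢ.K≤E (proj₁ (normal⇒fixedField isLᵢ normal))

    -- Being fixed by all embeddings over `M` puts `x` in `M` once `x` is separable over `M`. That
    -- separability is inherited from L over `Lᵢ`, which is Galois by Artin's theorem.
    normal⇒compositum : IsNormal L K → ∣ L ∣ ⊆ compositum Lₛ Lᵢ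
    normal⇒compositum normal {x} x∈ M Lₛ≤M Lᵢ≤M = fixed-separable⇒base {M} K≤M
      (λ h → fixes-separable⇒fixes {L} {L} K≤L id (IsEmbedding.isHom h)
        (λ y∈ simple → IsEmbedding.fixes h (Lₛ≤M (simpleRoot∈Lₛ y∈ simple))) x∈)
      (simpleRoot⇒separable {M} K≤M (simpleRoot-mono {Lᵢ} {M} Lᵢ≤M
          (separable⇒simpleRoot {Lᵢ} (proj₂ (normal⇒galoisOverLᵢ normal) x∈))))
      where
      K≤M : K ≤ M
      K≤M a∈ = Lₛ≤M (Lₛ.K≤E a∈)

    compositum≤L : compositum Lₛ Lᵢ ⊆ ∣ L ∣
    compositum≤L x∈ = x∈ L Lₛ.E≤L Lᵢ.E≤L

    Lₛ≤F⇒u≡1 : Lₛ ≤ F → [ Lₛ ∶ F ] ≡ 1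
    Lₛ≤F⇒u≡1 Lₛ≤F = LinearAlgebra.degree≡ F {Lₛ} {1} {λ _ → 1#} record
      { b∈L         = λ _ → Subfield.1∈ Lₛ
      ; spanning    = λ {x} x∈ → (λ _ → x) , (λ _ → Lₛ≤F x∈) , sym (trans (+-identityʳ _) (*-identityʳ x))
      ; independent = λ { a _ a≈0 zero → trans (sym (trans (+-identityʳ _) (*-identityʳ _))) a≈0 }
      }

    u≡1⇒Lₛ≤F : [ Lₛ ∶ F ] ≡ 1 → Lₛ ≤ F
    u≡1⇒Lₛ≤F u≡1 {x} x∈ = through (LinearAlgebra.nonZero-degree⇒basis F Lₛ u≡1)
      where
      module F′ = Subfield F
      through : Σ[ b ∈ (Fin 1 → Carrier) ] IsBasis Lₛ F b → x ∈ ∣ F ∣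
      through (b , basis) =
        let a , a∈ , 1≈ab = spanning (Subfield.1∈ Lₛ)
            d , d∈ , x≈db = spanning x∈
            -- Expanding 1 in the one-element basis shows the basis vector to be the inverse of an
            -- element of `F`, so it lies in `F` together with all its multiples.
            ab≈1 = trans (sym (+-identityʳ _)) (sym 1≈ab)
        in F′.resp (sym (trans x≈db (+-identityʳ _))) (F′.*-closed (d∈ zero) (F′.⁻¹-closed (a∈ zero) ab≈1))
        where open IsBasis basis

    normal⇒t≡[L:Lᵢ] : IsNormal L K → [ F ∶ K ] ≡ [ L ∶ Lᵢ ]
    normal⇒t≡[L:Lᵢ] normal = compositum⇒degree λ x∈ →
      compositum-monoˡ {Lₛ} {F} {Lᵢ} (normal⇒Lₛ≤F normal) (normal⇒compositum normal x∈)

    t≡[L:Lᵢ]⇒normal : [ F ∶ K ] ≡ [ L ∶ Lᵢ ] → IsNormal L K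
    t≡[L:Lᵢ]⇒normal t≡ = compositum⇒normal (degree⇒compositum t≡)

    normal⇒u≡1 : IsNormal L K → [ Lₛ ∶ F ] ≡ 1
    normal⇒u≡1 normal = Lₛ≤F⇒u≡1 (normal⇒Lₛ≤F normal)

    u≡1⇒normal : [ Lₛ ∶ F ] ≡ 1 → ∣ L ∣ ⊆ compositum Lₛ Lᵢ → IsNormal L K
    u≡1⇒normal u≡1 L⊆ = compositum⇒normal λ x∈ → compositum-monoˡ {Lₛ} {F} {Lᵢ} (u≡1⇒Lₛ≤F u≡1) (L⊆ x∈)

    galoisOverLᵢ⇒normal : IsGalois L Lᵢ → IsNormal L K
    galoisOverLᵢ⇒normal galois = normalOverLᵢ⇒normal isLᵢ (proj₁ galois)

    fixedField⇒normal : fixedField L K ≐ ∣ Lᵢ ∣ → IsNormal L K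
    fixedField⇒normal (fixed⊆ , _) = galoisOverLᵢ⇒normal (fixedField⇒galois {Lᵢ} Lᵢ.K≤E fixed⊆)

    normal⇔t≡[L:Lᵢ] : IsNormal L K ⇔ [ F ∶ K ] ≡ [ L ∶ Lᵢ ]
    normal⇔t≡[L:Lᵢ] = mk⇔ {A = IsNormal L K} {B = [ F ∶ K ] ≡ [ L ∶ Lᵢ ]}
      (λ a → normal⇒t≡[L:Lᵢ] a) (λ b → t≡[L:Lᵢ]⇒normal b)

    normal⇔u≡1×compositum : IsNormal L K ⇔ ([ Lₛ ∶ F ] ≡ 1 × ∣ L ∣ ≐ compositum Lₛ Lᵢ)
    normal⇔u≡1×compositum = mk⇔ {A = IsNormal L K} {B = [ Lₛ ∶ F ] ≡ 1 × ∣ L ∣ ≐ compositum Lₛ Lᵢ}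
      (λ a → normal⇒u≡1 a , normal⇒compositum a , compositum≤L) (λ (u≡1 , L⊆ , _) → u≡1⇒normal u≡1 L⊆)

    normal⇔fixedField : IsNormal L K ⇔ (fixedField L K ≐ ∣ Lᵢ ∣)
    normal⇔fixedField = mk⇔ {A = IsNormal L K} {B = fixedField L K ≐ ∣ Lᵢ ∣}
      (λ a → normal⇒fixedField isLᵢ a) (λ d → fixedField⇒normal d)

    normal⇔galoisOverLᵢ : IsNormal L K ⇔ IsGalois L Lᵢ
    normal⇔galoisOverLᵢ = mk⇔ {A = IsNormal L K} {B = IsGalois L Lᵢ}
      (λ a → normal⇒galoisOverLᵢ a) (λ e → galoisOverLᵢ⇒normal e)

corollary2p12p1 :
    (em : ∀ {a : Level} → ExcludedMiddle a) →
    ∀ {c ℓ₁ ℓ₂ : Level} (K̄ : HeytingField c ℓ₁ ℓ₂) →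
    let open FieldExtensions em K̄ in
    (K : Subfield) → IsAlgebraicClosureOf K →
    (L : Subfield) → IsFiniteExtension L K →
    (Lₛ Lᵢ F : Subfield) →
    IsLargestSubextension IsSeparable L K Lₛ →
    IsLargestSubextension IsPurelyInseparable L K Lᵢ →
    IsLargestSubextension IsGalois L K F →
    let t = [ F ∶ K ]
        u = [ Lₛ ∶ F ]
        ⟨a⟩ = IsNormal L K
        ⟨b⟩ = t ≡ [ L ∶ Lᵢ ]
        ⟨c⟩ = u ≡ 1 × ∣ L ∣ ≐ compositum Lₛ Lᵢ
        ⟨d⟩ = fixedField L K ≐ ∣ Lᵢ ∣
        ⟨e⟩ = IsGalois L Lᵢ
    in (⟨a⟩ ⇔ ⟨b⟩) × (⟨a⟩ ⇔ ⟨c⟩) × (⟨a⟩ ⇔ ⟨d⟩) × (⟨a⟩ ⇔ ⟨e⟩)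
corollary2p12p1 em K̄ K closure L L/K Lₛ Lᵢ F isLₛ isLᵢ isF =
  normal⇔t≡[L:Lᵢ] , normal⇔u≡1×compositum , normal⇔fixedField , normal⇔galoisOverLᵢ
  where
  open FieldTheory em K̄
  open Characterisations K closure L L/K Lₛ Lᵢ F isLₛ isLᵢ isF
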